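{- Let $s, t \geq 2$ be integers, let $G$ be a $\mathcal{J}_{s,t}$-minor-free graph, and let $(T, \mathcal{W})$ be a tree-decomposition of $G$. Then $G$ has a partition of $\mathcal{W}$-width at most $t-1$ and treewidth at most $s$.
   Context: All graphs are finite, simple and undirected. $\mathcal{J}_{s,t}$ is the class of graphs whose vertex-set has a partition $A \cup B$ with $|A| = s$, $|B| = t$, $A$ a clique, every vertex of $A$ adjacent to every vertex of $B$, and $G[B]$ connected. A graph is $\mathcal{J}_{s,t}$-minor-free if it contains no graph of $\mathcal{J}_{s,t}$ as a minor. A tree-decomposition $(T,\mathcal{W})$, $\mathcal{W} = (W_x : x \in V(T))$, consists of a tree $T$ and bags $W_x \subseteq V(G)$ such that for each vertex $v$ the nodes whose bags contain $v$ induce a non-empty connected subtree of $T$, and each edge has both ends in some bag. A partition of $G$ is a graph $H$ whose vertices (called parts) are sets of vertices of $G$, such that each vertex of $G$ lies in exactly one part, and for every edge $vw$ of $G$ with $v \in X \in V(H)$, $w \in Y \in V(H)$, either $X = Y$ or $XY \in E(H)$. The treewidth of a partition $H$ is $\mathrm{tw}(H)$. The $\mathcal{W}$-width of a set $S \subseteq V(G)$ is the minimum number of bags of $\mathcal{W}$ whose union contains $S$; the $\mathcal{W}$-width of a partition $H$ is the maximum $\mathcal{W}$-width of a part of $H$. -}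

module Defs where

open import Data.Nat using (ℕ; zero; suc; _+_; _∸_; _≤_; _<_)
open import Data.Fin using (Fin)
open import Data.Fin.Subset using (Subset; _∈_; _∉_; ∣_∣)
open import Data.Bool using (Bool; T)
open import Data.Maybe using (Maybe; just)
open import Data.List using (List; []; _∷_; _++_; [_]; length)
open import Data.List.Relation.Unary.Unique.Propositional using (Unique)
open import Data.Product using (Σ; ∃; ∃-syntax; _×_; _,_)
open import Data.Sum using (_⊎_)
open import Data.Unit using (⊤)
open import Relation.Nullary using (¬_)
open import Relation.Binary.PropositionalEquality using (_≡_; _≢_)

record Graph : Set where
  field
    n      : ℕ
    adj    : Fin n → Fin n → Bool
    adj-sym : ∀ u v → adj u v ≡ adj v u
    adj-irr : ∀ u → ¬ T (adj u u)
open Graph public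

V : Graph → Set
V G = Fin (n G)

Adj : (G : Graph) → V G → V G → Set
Adj G u v = T (adj G u v)

data Reach (G : Graph) (S : V G → Set) : V G → V G → Set where
  here : ∀ {u} → S u → Reach G S u u
  step : ∀ {u w v} → Reach G S u w → Adj G w v → S v → Reach G S u v

ConnectedIn : (G : Graph) → (V G → Set) → Set
ConnectedIn G S = ∀ {u v} → S u → S v → Reach G S u v

Connected : Graph → Set
Connected G = ConnectedIn G (λ _ → ⊤)

Linked : (G : Graph) → List (V G) → Set
Linked G (x ∷ y ∷ r) = Adj G x y × Linked G (y ∷ r)
Linked G _ = ⊤

HasCycle : Graph → Set
HasCycle G = Σ (V G) λ x → Σ (List (V G)) λ r →
  Unique (x ∷ r) × 2 ≤ length r × Linked G (x ∷ r ++ [ x ])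

IsTree : Graph → Set
IsTree G = 0 < n G × Connected G × ¬ HasCycle G

-- H is a minor of G: branch sets given by β (vertex v of G lies in the
-- branch set of x iff β v ≡ just x; so branch sets are pairwise disjoint),
-- each nonempty and inducing a connected subgraph, and each edge of H
-- realised by an edge of G between the corresponding branch sets.
IsMinor : Graph → Graph → Set
IsMinor H G = Σ (V G → Maybe (V H)) λ β →
    (∀ x → ∃[ v ] β v ≡ just x)
  × (∀ x → ConnectedIn G (λ v → β v ≡ just x))
  × (∀ x y → Adj H x y → ∃[ u ] ∃[ v ] (β u ≡ just x × β v ≡ just y × Adj G u v))

InJ : ℕ → ℕ → Graph → Set
InJ s t H = Σ (Subset (n H)) λ A →
    n H ≡ s + t
  × ∣ A ∣ ≡ s
  × (∀ u v → u ∈ A → v ∈ A → u ≢ v → Adj H u v)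
  × (∀ u v → u ∈ A → v ∉ A → Adj H u v)
  × ConnectedIn H (λ v → v ∉ A)

JMinorFree : ℕ → ℕ → Graph → Set
JMinorFree s t G = ∀ (H : Graph) → InJ s t H → ¬ IsMinor H G

record TreeDecomposition (G : Graph) : Set where
  field
    Tr     : Graph
    isTree : IsTree Tr
    W      : V Tr → Subset (n G)
    vertex-nonempty : ∀ v → ∃[ x ] v ∈ W x
    vertex-subtree  : ∀ v → ConnectedIn Tr (λ x → v ∈ W x)
    edge-covered    : ∀ u v → Adj G u v → ∃[ x ] (u ∈ W x × v ∈ W x)
open TreeDecomposition public

TreewidthAtMost : ℕ → Graph → Set
TreewidthAtMost k H = Σ (TreeDecomposition H) λ D → ∀ x → ∣ W D x ∣ ≤ suc k

-- A partition of G: a graph H whose vertices are the (nonempty) parts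
-- {v | part v ≡ X}; each vertex of G is in exactly one part.
record Partition (G : Graph) : Set where
  field
    H         : Graph
    part      : V G → V H
    part-nonempty : ∀ X → ∃[ v ] part v ≡ X
    part-edge : ∀ v w → Adj G v w → part v ≡ part w ⊎ Adj H (part v) (part w)
open Partition public

WWidthSetAtMost : {G : Graph} → TreeDecomposition G → ℕ → (V G → Set) → Set
WWidthSetAtMost D k S = Σ (Subset (n (Tr D))) λ C →
  ∣ C ∣ ≤ k × (∀ v → S v → ∃[ x ] (x ∈ C × v ∈ W D x))

WWidthAtMost : {G : Graph} → TreeDecomposition G → ℕ → Partition G → Set
WWidthAtMost D k P = ∀ X → WWidthSetAtMost D k (λ v → part P v ≡ X)

{-# OPTIONS --safe #-}

-- The parts are chosen one at a time.  A component C of the vertices not yet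
-- assigned has at most s neighbouring parts, the i-th of which meets N(C) inside
-- a set R i; the R i are disjoint from each other and from C, and those that C
-- touches are connected and pairwise adjacent.  Call a subset of C full if it
-- touches every R i that C touches.
--
-- If C touches all s sets, t disjoint full connected subsets of C would extend
-- to a partition of C into connected sets and yield a minor in J_{s,t}; so, by
-- the Erdős–Pósa property of connected subgraphs in a tree-decomposition,
-- t - 1 bags meet all full connected subsets, and P is the trace of these bags
-- on C.  If some R i is untouched, one bag suffices: root the tree, let y be a
-- lowest node such that the vertices with all their bags in the subtree of y
-- induce a full component M in C, and let P be the trace of W y on N[M].  Then
-- a component of C - P either is not full or avoids N[M]; in the latter case
-- N[M] replaces R i.
--
-- Finally P is shrunk: while a component K of C - P and a component Q of C - K
-- both miss the same touched R i, the vertices of Q leave P.  At the end, if K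
-- misses R i, then R i ∪ (C - K) is connected, contains P, and replaces R i.

module Submission where

open import Defs
open import Data.Nat using (ℕ; zero; suc; _+_; _∸_; _≤_; _<_; _<?_; z≤n; s≤s)
import Data.Nat.Properties as ℕ
open import Data.Nat.Induction using (<-wellFounded)
open import Data.Fin using (Fin; zero; suc; toℕ; fromℕ<; _↑ˡ_; _↑ʳ_; splitAt)
import Data.Fin.Properties as Fin
open import Data.Fin.Subset using (Subset; _∈_; _∉_; _⊆_; _⊂_; _⊃_; ∣_∣; _∩_; _∪_; _─_; _-_; ∁; ⁅_⁆; ⋃; inside)
  renaming (⊥ to ∅)
open import Data.Fin.Subset.Properties
open import Data.Fin.Subset.Induction using (⊂-wellFounded; ⊃-wellFounded; Acc; acc)
open import Data.Bool using (Bool; true; T)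
open import Data.Bool.Properties using (T?)
open import Data.Empty using (⊥; ⊥-elim)
open import Data.List using (List; []; _∷_; length; map; tabulate; _++_; [_])
open import Data.List.Properties using (length-tabulate; length-++; ++-assoc)
open import Data.List.Relation.Unary.All using (All; []; _∷_)
import Data.List.Relation.Unary.All as All
open import Data.List.Relation.Unary.Any using (here; there)
open import Data.List.Relation.Unary.AllPairs using ([]; _∷_)
open import Data.List.Relation.Unary.Unique.Propositional using (Unique)
import Data.List.Relation.Unary.Unique.Propositional.Properties as Unique
import Data.List.Membership.Propositional as List
import Data.List.Membership.Propositional.Properties as List
open import Data.Maybe using (Maybe; just; nothing)
import Data.Maybe as Maybe
open import Data.Maybe.Properties using (just-injective; ≡-dec)
open import Data.Product using (Σ; ∃-syntax; _×_; _,_; proj₁; proj₂)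
open import Data.Sum using (_⊎_; inj₁; inj₂; [_,_]′)
open import Data.Unit using (⊤; tt)
import Data.Vec as Vec
open import Data.Vec.Properties using (lookup∘tabulate; lookup⇒[]=; []=⇒lookup)
open import Function using (case_of_)
open import Function.Bundles using (mk⇔)
open import Relation.Nullary using (¬_; Dec; yes; no; does)
open import Relation.Nullary.Decidable
  using (_×-dec_; _⊎-dec_; _→-dec_; ¬?; dec-true; map′; ⌊_⌋; toWitness; fromWitness; isYes≗does; does-⇔)
open import Relation.Binary.PropositionalEquality using (_≡_; _≢_; refl; sym; trans; cong; subst; ≢-sym)

-- Finite subsets

opaque
  ⟦_⟧ : ∀ {n} {P : Fin n → Set} → (∀ x → Dec (P x)) → Subset n
  ⟦ P? ⟧ = Vec.tabulate (λ x → does (P? x))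

  ∈⟦⟧⁺ : ∀ {n} {P : Fin n → Set} (P? : ∀ x → Dec (P x)) {x} → P x → x ∈ ⟦ P? ⟧
  ∈⟦⟧⁺ P? {x} p = lookup⇒[]= x _ (trans (lookup∘tabulate _ x) (dec-true (P? x) p))

  ∈⟦⟧⁻ : ∀ {n} {P : Fin n → Set} (P? : ∀ x → Dec (P x)) {x} → x ∈ ⟦ P? ⟧ → P x
  ∈⟦⟧⁻ P? {x} q with P? x | trans (sym (lookup∘tabulate (λ x → does (P? x)) x)) ([]=⇒lookup q)
  ... | yes p | _ = p
  ... | no _  | ()

∈─⁻ : ∀ {n} (p q : Subset n) {x} → x ∈ p ─ q → x ∈ p × x ∉ q
∈─⁻ p q {x} h = p─q⊆p p q h , λ x∈q →
  subst (x ∉_) (p─q─q≡p─q p q) (λ h′ → go p q h x∈q) h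
  where
  go : ∀ {n} (p q : Subset n) {x} → x ∈ p ─ q → x ∉ q
  go (_ Vec.∷ p) (Bool.false Vec.∷ q) Vec.here ()
  go (_ Vec.∷ p) (_ Vec.∷ q) (Vec.there h) (Vec.there k) = go p q h k

⋃-∈ : ∀ {n} {ps : List (Subset n)} {p x} → p List.∈ ps → x ∈ p → x ∈ ⋃ ps
⋃-∈ {ps = p ∷ ps} (here refl) x∈p = x∈p∪q⁺ (inj₁ x∈p)
⋃-∈ {ps = q ∷ ps} (there p∈)  x∈p = x∈p∪q⁺ (inj₂ (⋃-∈ p∈ x∈p))

∣p∪q∣≤∣p∣+∣q∣ : ∀ {n} (p q : Subset n) → ∣ p ∪ q ∣ ≤ ∣ p ∣ + ∣ q ∣
∣p∪q∣≤∣p∣+∣q∣ Vec.[] Vec.[] = z≤n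
∣p∪q∣≤∣p∣+∣q∣ (true Vec.∷ p) (true Vec.∷ q) =
  s≤s (ℕ.≤-trans (∣p∪q∣≤∣p∣+∣q∣ p q) (ℕ.+-monoʳ-≤ ∣ p ∣ (ℕ.n≤1+n _)))
∣p∪q∣≤∣p∣+∣q∣ (true Vec.∷ p) (Bool.false Vec.∷ q) = s≤s (∣p∪q∣≤∣p∣+∣q∣ p q)
∣p∪q∣≤∣p∣+∣q∣ (Bool.false Vec.∷ p) (true Vec.∷ q) =
  ℕ.≤-trans (s≤s (∣p∪q∣≤∣p∣+∣q∣ p q)) (ℕ.≤-reflexive (sym (ℕ.+-suc ∣ p ∣ ∣ q ∣)))
∣p∪q∣≤∣p∣+∣q∣ (Bool.false Vec.∷ p) (Bool.false Vec.∷ q) = ∣p∪q∣≤∣p∣+∣q∣ p q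

-- Counts both the nodes covering a part and the labels in a bag. The values of `f` may be empty, as
-- happens for the dummy label 0.
∣⋃∣≤length : ∀ {A : Set} {n} (f : A → Subset n) → (∀ a → ∣ f a ∣ ≤ 1) →
  ∀ xs → ∣ ⋃ (map f xs) ∣ ≤ length xs
∣⋃∣≤length {n = n} f ≤1 [] = ℕ.≤-reflexive (∣⊥∣≡0 n)
∣⋃∣≤length f ≤1 (x ∷ xs) = ℕ.≤-trans (∣p∪q∣≤∣p∣+∣q∣ (f x) _)
  (ℕ.+-mono-≤ (≤1 x) (∣⋃∣≤length f ≤1 xs))

∣⋃⁅⁆∣≤length : ∀ {n} (xs : List (Fin n)) → ∣ ⋃ (map ⁅_⁆ xs) ∣ ≤ length xs
∣⋃⁅⁆∣≤length = ∣⋃∣≤length ⁅_⁆ λ x → ℕ.≤-reflexive (∣⁅x⁆∣≡1 x)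

subsingleton⇒∣p∣≤1 : ∀ {n} {p : Subset n} → (∀ {x y} → x ∈ p → y ∈ p → x ≡ y) → ∣ p ∣ ≤ 1
subsingleton⇒∣p∣≤1 {n} {p} sub with nonempty? p
... | no empty = subst (λ q → ∣ q ∣ ≤ 1) (sym (Empty-unique empty)) (ℕ.≤-trans (ℕ.≤-reflexive (∣⊥∣≡0 n)) z≤n)
... | yes (x , x∈p) = ℕ.≤-trans
  (p⊆q⇒∣p∣≤∣q∣ {p = p} {⁅ x ⁆} λ y∈p → subst (_∈ ⁅ x ⁆) (sub x∈p y∈p) (x∈⁅x⁆ x))
  (ℕ.≤-reflexive (∣⁅x⁆∣≡1 x))

∈⋃-map⁻ : ∀ {A : Set} {n} {f : A → Subset n} xs {v} → v ∈ ⋃ (map f xs) →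
  ∃[ x ] (x List.∈ xs × v ∈ f x)
∈⋃-map⁻ [] v∈ = ⊥-elim (∉⊥ v∈)
∈⋃-map⁻ {f = f} (x ∷ xs) v∈ with x∈p∪q⁻ (f x) _ v∈
... | inj₁ v∈fx = x , here refl , v∈fx
... | inj₂ v∈⋃ = let y , y∈ , v∈fy = ∈⋃-map⁻ xs v∈⋃ in y , there y∈ , v∈fy

∈⋃⁅⁆ : ∀ {n} {xs : List (Fin n)} {x} → x List.∈ xs → x ∈ ⋃ (map ⁅_⁆ xs)
∈⋃⁅⁆ x∈xs = ⋃-∈ (List.∈-map⁺ ⁅_⁆ x∈xs) (x∈⁅x⁆ _)

-- Reachability and components

module Reachability (G : Graph) where

  Adj? : ∀ u v → Dec (Adj G u v)
  Adj? u v = T? (adj G u v)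

  Adj-sym : ∀ {u v} → Adj G u v → Adj G v u
  Adj-sym {u} {v} = subst T (adj-sym G u v)

  module _ {S : V G → Set} where

    start : ∀ {u v} → Reach G S u v → S u
    start (here s) = s
    start (step r _ _) = start r

    end : ∀ {u v} → Reach G S u v → S v
    end (here s) = s
    end (step _ _ s) = s

    reach-trans : ∀ {u v w} → Reach G S u v → Reach G S v w → Reach G S u w
    reach-trans r (here _) = r
    reach-trans r (step r′ a s) = step (reach-trans r r′) a s

    reach-sym : ∀ {u v} → Reach G S u v → Reach G S v u
    reach-sym (here s) = here s
    reach-sym (step r a s) = reach-trans (step (here s) (Adj-sym a) (end r)) (reach-sym r)

    -- Going back along the walk from its end, the first vertex found in `Q` starts an edge that
    -- leaves `Q`.
    crossing : {Q : V G → Set} → (∀ x → Dec (Q x)) → ∀ {u v} → Reach G S u v → Q u → ¬ Q v →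
      ∃[ a ] ∃[ b ] (Q a × ¬ Q b × Adj G a b × S a × S b)
    crossing Q? (here _) q ¬q = ⊥-elim (¬q q)
    crossing Q? (step {w = w} {v = v} r a s) q ¬q with Q? w
    ... | yes qw = w , v , qw , ¬q , a , end r , s
    ... | no ¬qw = crossing Q? r q ¬qw

  reach-mono : ∀ {S S′ : V G → Set} → (∀ {x} → S x → S′ x) →
    ∀ {u v} → Reach G S u v → Reach G S′ u v
  reach-mono f (here s) = here (f s)
  reach-mono f (step r a s) = step (reach-mono f r) a (f s)

  reach-into : ∀ {S Q : V G → Set} → (∀ {a b} → Q a → Adj G a b → S b → Q b) →
    ∀ {u v} → Q u → Reach G S u v → Reach G Q u v
  reach-into closed q (here _) = here q
  reach-into closed q (step r a s) = step r′ a (closed (end r′) a s)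
    where r′ = reach-into closed q r

  -- Cut the walk at its last visit to `u`; what remains avoids `u`. So `reach?` and `simplePath`
  -- can recurse on `S`, which loses `u` at each call.
  reach-unstep : ∀ {S : Subset (n G)} {u v} → Reach G (_∈ S) u v →
    u ≡ v ⊎ ∃[ w ] (Adj G u w × Reach G (_∈ S - u) w v)
  reach-unstep (here _) = inj₁ refl
  reach-unstep {u = u} {v} (step r a s) with v Fin.≟ u
  ... | yes refl = inj₁ refl
  ... | no v≢u with reach-unstep r
  ... | inj₁ refl = inj₂ (v , a , here (x∈p∧x≢y⇒x∈p-y s v≢u))
  ... | inj₂ (w , b , r′) = inj₂ (w , b , step r′ a (x∈p∧x≢y⇒x∈p-y s v≢u))

  private
    reach?′ : ∀ S → Acc _⊂_ S → ∀ u v → Dec (Reach G (_∈ S) u v)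
    reach?′ S (acc rec) u v with u ∈? S
    ... | no u∉S = no λ r → u∉S (start r)
    ... | yes u∈S with u Fin.≟ v
    ... | yes refl = yes (here u∈S)
    ... | no u≢v = map′ to from
          (Fin.any? λ w → Adj? u w ×-dec reach?′ (S - u) (rec (x∈p⇒p-x⊂p u∈S)) w v)
      where
      to : ∃[ w ] (Adj G u w × Reach G (_∈ S - u) w v) → Reach G (_∈ S) u v
      to (w , a , r) = reach-trans
        (step (here u∈S) a (p─q⊆p S ⁅ u ⁆ (start r))) (reach-mono (p─q⊆p S ⁅ u ⁆) r)
      from : Reach G (_∈ S) u v → ∃[ w ] (Adj G u w × Reach G (_∈ S - u) w v)
      from r = [ (λ u≡v → ⊥-elim (u≢v u≡v)) , (λ p → p) ]′ (reach-unstep r)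

  reach? : ∀ S u v → Dec (Reach G (_∈ S) u v)
  reach? S = reach?′ S (⊂-wellFounded S)

  opaque
    comp : Subset (n G) → V G → Subset (n G)
    comp S u = ⟦ reach? S u ⟧

    ∈comp⁺ : ∀ {S u v} → Reach G (_∈ S) u v → v ∈ comp S u
    ∈comp⁺ {S} {u} = ∈⟦⟧⁺ (reach? S u)

    ∈comp⁻ : ∀ {S u v} → v ∈ comp S u → Reach G (_∈ S) u v
    ∈comp⁻ {S} {u} = ∈⟦⟧⁻ (reach? S u)

  comp⊆ : ∀ {S u} → comp S u ⊆ S
  comp⊆ h = end (∈comp⁻ h)

  comp-self : ∀ {S u} → u ∈ S → u ∈ comp S u
  comp-self s = ∈comp⁺ (here s)

  comp-step : ∀ {S u v w} → v ∈ comp S u → Adj G v w → w ∈ S → w ∈ comp S u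
  comp-step h a s = ∈comp⁺ (step (∈comp⁻ h) a s)

  comp-connected : ∀ {S u} → ConnectedIn G (_∈ comp S u)
  comp-connected {S} {u} p q = reach-into (λ h a s → comp-step h a s) p
    (reach-trans (reach-sym (∈comp⁻ p)) (∈comp⁻ q))

  comp-least : ∀ {S u} {Q : Subset (n G)} → u ∈ Q →
    (∀ {a b} → a ∈ Q → Adj G a b → b ∈ S → b ∈ Q) → comp S u ⊆ Q
  comp-least q closed h = end (reach-into closed q (∈comp⁻ h))

  -- Otherwise the walk back from a vertex of `Q` to `u` would leave `Q` along an edge inside `S`.
  comp-avoids : ∀ {S u} {Q : Subset (n G)} → u ∉ Q →
    (∀ {a b} → a ∈ Q → Adj G a b → a ∈ S → b ∈ S → b ∈ Q) → ∀ {x} → x ∈ comp S u → x ∉ Q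
  comp-avoids {Q = Q} u∉Q closed h q with crossing (_∈? Q) (reach-sym (∈comp⁻ h)) q u∉Q
  ... | a , b , qa , ¬qb , e , sa , sb = ¬qb (closed qa e sa sb)

  comp-mono : ∀ {S S′ u} → S ⊆ S′ → comp S u ⊆ comp S′ u
  comp-mono S⊆S′ h = ∈comp⁺ (reach-mono S⊆S′ (∈comp⁻ h))

  last : V G → List (V G) → V G
  last x [] = x
  last x (y ∷ l) = last y l

  Linked-++ : ∀ x l y r → Linked G (x ∷ l) → Adj G (last x l) y → Linked G (y ∷ r) →
    Linked G (x ∷ l ++ y ∷ r)
  Linked-++ x [] y r _ a q = a , q
  Linked-++ x (z ∷ l) y r (b , p) a q = b , Linked-++ z l y r p a q

  -- A walk in `Reach` may repeat vertices, while `HasCycle` asks for a list without repetition; two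
  -- such paths are later joined to a cycle.
  record SimplePath (S : Subset (n G)) (u v : V G) : Set where
    field
      rest   : List (V G)
      unique : Unique (u ∷ rest)
      inS    : All (_∈ S) (u ∷ rest)
      linked : Linked G (u ∷ rest)
      ends   : last u rest ≡ v

  simplePath : ∀ {S u v} → Reach G (_∈ S) u v → SimplePath S u v
  simplePath {S} = go S (⊂-wellFounded S)
    where
    go : ∀ S → Acc _⊂_ S → ∀ {u v} → Reach G (_∈ S) u v → SimplePath S u v
    go S (acc rec) {u} r with reach-unstep r
    ... | inj₁ refl = record
      { rest = [] ; unique = [] ∷ [] ; inS = start r ∷ [] ; linked = tt ; ends = refl }
    ... | inj₂ (w , a , r′) = record
      { rest = w ∷ rest
      ; unique = All.map (λ x∈ u≡x → proj₂ (∈─⁻ S ⁅ u ⁆ x∈) (subst (_∈ ⁅ u ⁆) u≡x (x∈⁅x⁆ u))) inS ∷ unique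
      ; inS = start r ∷ All.map (p─q⊆p S ⁅ u ⁆) inS
      ; linked = a , linked
      ; ends = ends }
      where open SimplePath (go (S - u) (rec (x∈p⇒p-x⊂p (start r))) r′)

-- Bottlenecks in tree-decompositions

module TreeOrder (Tr : Graph) (tree : IsTree Tr) where
  open Reachability Tr

  -- Quantifying over `z` expresses "unless `X` is empty", so the first node needs no separate case.
  Attached : Subset (n Tr) → V Tr → Set
  Attached X y = ∀ {z} → z ∈ X → ∃[ p ] (p ∈ X × Adj Tr p y)

  -- Initial segments of a search order. They stand in for a rooted tree: the first node is the
  -- root, and every later node comes after its parent.
  data Ord : Subset (n Tr) → Set where
    nil : Ord ∅
    ext : ∀ {X y} → Ord X → y ∉ X → Attached X y → Ord (⁅ y ⁆ ∪ X)

  Ord-connected : ∀ {X} → Ord X → ConnectedIn Tr (_∈ X)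
  Ord-connected nil u∈ _ = ⊥-elim (∉⊥ u∈)
  Ord-connected (ext {X} {y} o _ att) {u} {v} u∈ v∈
    with x∈p∪q⁻ ⁅ y ⁆ X u∈ | x∈p∪q⁻ ⁅ y ⁆ X v∈
  ... | inj₁ u≡y | inj₁ v≡y rewrite x∈⁅y⁆⇒x≡y y u≡y | x∈⁅y⁆⇒x≡y y v≡y = here v∈
  ... | inj₂ u∈X | inj₂ v∈X = reach-mono (q⊆p∪q ⁅ y ⁆ X) (Ord-connected o u∈X v∈X)
  ... | inj₂ u∈X | inj₁ v≡y rewrite x∈⁅y⁆⇒x≡y y v≡y =
    let p , p∈X , a = att u∈X in step (reach-mono (q⊆p∪q ⁅ y ⁆ X) (Ord-connected o u∈X p∈X)) a v∈
  ... | inj₁ u≡y | inj₂ v∈X rewrite x∈⁅y⁆⇒x≡y y u≡y =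
    let p , p∈X , a = att v∈X in
    reach-sym (step (reach-mono (q⊆p∪q ⁅ y ⁆ X) (Ord-connected o v∈X p∈X)) a u∈)

  -- A second edge between X and the component of y outside X would close a cycle.
  sole-attachment : ∀ {X y} → Ord X → Attached X y → ∀ {x z} →
    Reach Tr (_∈ ∁ X) y x → z ∈ X → Adj Tr x z → x ≡ y
  sole-attachment {X} {y} o att {x} {z} r z∈X xz with att z∈X
  ... | p , p∈X , py = close (simplePath r) (simplePath (Ord-connected o z∈X p∈X))
    where
    close : SimplePath (∁ X) y x → SimplePath X z p → x ≡ y
    close record { rest = [] ; ends = y≡x } _ = sym y≡x
    close record { rest = l@(w ∷ l′) ; unique = u₁ ; inS = s₁ ; linked = k₁ ; ends = e₁ }
          record { rest = r ; unique = u₂ ; inS = s₂ ; linked = k₂ ; ends = e₂ } =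
      ⊥-elim (proj₂ (proj₂ tree) (y , l ++ z ∷ r
        , Unique.++⁺ u₁ u₂ (λ (p , q) → x∈∁p⇒x∉p (All.lookup s₁ p) (All.lookup s₂ q))
        , s≤s (ℕ.≤-trans (ℕ.m≤n+m 1 (length l′ + length r)) (ℕ.≤-reflexive len))
        , subst (λ c → Linked Tr (y ∷ c)) (sym (++-assoc l (z ∷ r) [ y ]))
            (Linked-++ y l z (r ++ [ y ]) k₁ (subst (λ v → Adj Tr v z) (sym e₁) xz)
              (Linked-++ z r y [] k₂ (subst (λ v → Adj Tr v y) (sym e₂) py) tt))))
      where
      len : length l′ + length r + 1 ≡ length (l′ ++ z ∷ r)
      len = trans (ℕ.+-assoc (length l′) (length r) 1)
        (trans (cong (length l′ +_) (ℕ.+-comm (length r) 1)) (sym (length-++ l′)))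

  opaque
    -- As the tree is connected, an edge leaves every nonempty proper segment, and its outer end can
    -- be added.
    complete : ∃[ X ] (Ord X × ∀ x → x ∈ X)
    complete = go ∅ nil (⊃-wellFounded ∅)
      where
      grow : ∀ X → Ord X → ∀ {y} → y ∉ X → ∃[ b ] (b ∉ X × Attached X b)
      grow X o {y} y∉X with nonempty? X
      ... | no empty = y , y∉X , λ z∈X → ⊥-elim (empty (_ , z∈X))
      ... | yes (z , z∈X) with crossing (_∈? X) (proj₁ (proj₂ tree) {z} {y} tt tt) z∈X y∉X
      ... | a , b , a∈X , b∉X , ab , _ = b , b∉X , λ _ → a , a∈X , ab
      go : ∀ X → Ord X → Acc _⊃_ X → ∃[ X ] (Ord X × ∀ x → x ∈ X)
      go X o (acc rec) with Fin.any? (λ y → ¬? (y ∈? X))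
      ... | no none = X , o , λ x → case x ∈? X of λ where
              (yes x∈X) → x∈X
              (no x∉X) → ⊥-elim (none (x , x∉X))
      ... | yes (y , y∉X) = let b , b∉X , att = grow X o y∉X in
        go (⁅ b ⁆ ∪ X) (ext o b∉X att)
           (rec (q⊆p∪q ⁅ b ⁆ X , b , x∈p∪q⁺ (inj₁ (x∈⁅x⁆ b)) , b∉X))

module Bottlenecks {G : Graph} (D : TreeDecomposition G) where
  open Reachability G
  private module T = Reachability (Tr D)
  open TreeOrder (Tr D) (isTree D)

  above? : ∀ X v → Dec (∃[ z ] (z ∈ X × v ∈ W D z))
  above? X v = Fin.any? λ z → (z ∈? X) ×-dec (v ∈? W D z)

  -- For an initial segment `X`, these vertices have all their bags in the subtrees hanging off `X`.
  Low : Subset (n (Tr D)) → Subset (n G)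
  Low X = ⟦ (λ v → ¬? (above? X v)) ⟧

  Low⁻ : ∀ {X v z} → v ∈ Low X → v ∈ W D z → z ∉ X
  Low⁻ {X} v∈ v∈W z∈X = ∈⟦⟧⁻ (λ v → ¬? (above? X v)) v∈ (_ , z∈X , v∈W)

  Low⁺ : ∀ {X v} → (∀ {z} → v ∈ W D z → z ∉ X) → v ∈ Low X
  Low⁺ {X} f = ∈⟦⟧⁺ (λ v → ¬? (above? X v)) λ (z , z∈X , v∈W) → f v∈W z∈X

  -- Consecutive vertices of the walk share a bag, and the nodes of each vertex form a connected set
  -- avoiding `X`, so the component of `y` in the tree without `X` is never left.
  bags-below : ∀ {X y u v} → u ∈ W D y → Reach G (_∈ Low X) u v →
    ∀ {x} → v ∈ W D x → Reach (Tr D) (_∈ ∁ X) y x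
  bags-below {X} {u = u} u∈ (here low) v∈ =
    T.reach-mono (λ h → x∉p⇒x∈∁p (Low⁻ low h)) (vertex-subtree D u u∈ v∈)
  bags-below u∈ (step {w = w} {v = v} r wv low) v∈ =
    let x , w∈x , v∈x = edge-covered D w v wv in
    T.reach-trans (bags-below u∈ r w∈x)
      (T.reach-mono (λ h → x∉p⇒x∈∁p (Low⁻ low h)) (vertex-subtree D v v∈x v∈))

  -- The nodes of `w` lead from one below `y`, where `w` shares a bag with `v`, to one in `X`. The
  -- tree edge by which they leave the component of `y` outside `X` ends in `X`, so by
  -- `sole-attachment` it starts at `y`.
  exit-in-bag : ∀ {X y} → Ord X → Attached X y → ∀ {u v w} → u ∈ W D y →
    Reach G (_∈ Low X) u v → Adj G v w → w ∉ Low X → w ∈ W D y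
  exit-in-bag {X} {y} o att {v = v} {w} u∈ r vw ¬low with above? X w
  ... | no ¬above = ⊥-elim (¬low (Low⁺ λ w∈ z∈ → ¬above (_ , z∈ , w∈)))
  ... | yes (z , z∈X , w∈z) with edge-covered D v w vw
  ... | x , v∈x , w∈x with T.crossing (T.reach? (∁ X) y) (vertex-subtree D w w∈x w∈z)
                             (bags-below u∈ r v∈x) (λ q → x∈∁p⇒x∉p (T.end q) z∈X)
  ... | a , b , ya , ¬yb , ab , w∈a , w∈b with b ∈? X
  ... | no b∉X = ⊥-elim (¬yb (step ya ab (x∉p⇒x∈∁p b∉X)))
  ... | yes b∈X = subst (λ a → w ∈ W D a) (sole-attachment o att ya b∈X ab) w∈a

  module _ (Full : Subset (n G) → Set) (Full? : ∀ S → Dec (Full S))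
           (Full-mono : ∀ {S S′} → S ⊆ S′ → Full S → Full S′) where

    -- By `exits` the bag at `y` separates `M` from the rest of `S`; by `minimal` it meets every
    -- full connected subset of `M`. An arbitrary `S′` is allowed because `erdős-pósa` and
    -- `initial-spare` delete different sets.
    record Bottleneck (S : Subset (n G)) : Set where
      field
        y         : V (Tr D)
        M         : Subset (n G)
        M⊆S       : M ⊆ S
        connected : ConnectedIn G (_∈ M)
        nonempty  : ∃[ v ] v ∈ M
        isFull    : Full M
        exits     : ∀ {a b} → a ∈ M → Adj G a b → b ∈ S → b ∉ M → b ∈ W D y
        minimal   : ∀ {S′ w} → w ∈ S′ → comp S′ w ⊆ M → (∀ {x} → x ∈ S′ → x ∉ W D y) →
                    ¬ Full (comp S′ w)

    opaque
      -- Start from all nodes, where `Low` is empty since every vertex has a bag, and undo the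
      -- search order. The first node `y` whose removal makes a full component appear is a lowest
      -- one, and that component is `M`. It appears at the latest for `Low ∅`, which contains `S`.
      bottleneck : ∀ {S v} → v ∈ S → Full (comp S v) → Bottleneck S
      bottleneck {S} {v} v∈S fullv = let X , o , all = complete in
        go o λ w∈ → ⊥-elim (Low⁻ (q∩ w∈) (proj₂ (vertex-nonempty D _)) (all _))
        where
        q∩ : ∀ {X x} → x ∈ S ∩ Low X → x ∈ Low X
        q∩ {X} h = proj₂ (x∈p∩q⁻ S (Low X) h)
        p∩ : ∀ {X x} → x ∈ S ∩ Low X → x ∈ S
        p∩ {X} h = proj₁ (x∈p∩q⁻ S (Low X) h)
        go : ∀ {X} → Ord X → (∀ {w} → w ∈ S ∩ Low X → ¬ Full (comp (S ∩ Low X) w)) → Bottleneck S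
        go nil none = ⊥-elim (none (S⊆ v∈S) (Full-mono (comp-mono S⊆) fullv))
          where
          S⊆ : S ⊆ S ∩ Low ∅
          S⊆ x∈S = x∈p∩q⁺ (x∈S , Low⁺ λ _ → ∉⊥)
        go (ext {X} {y} o y∉X att) none
          with Fin.any? (λ w → (w ∈? S ∩ Low X) ×-dec Full? (comp (S ∩ Low X) w))
        ... | no none′ = go o λ w∈ f → none′ (_ , w∈ , f)
        ... | yes (w , w∈ , fullw) = record
          { y = y ; M = M ; M⊆S = λ h → p∩ {X} (comp⊆ h)
          ; connected = comp-connected
          ; nonempty = w , comp-self w∈
          ; isFull = fullw
          ; exits = exits
          ; minimal = minimal
          }
          where
          M : Subset (n G)
          M = comp (S ∩ Low X) w
          low : ∀ {x} → x ∈ M → x ∉ W D y → x ∈ S ∩ Low (⁅ y ⁆ ∪ X)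
          low {x} x∈M x∉y = x∈p∩q⁺ (p∩ {X} (comp⊆ x∈M) , Low⁺ λ {z} x∈z z∈ → case x∈p∪q⁻ ⁅ y ⁆ X z∈ of λ where
            (inj₁ z≡y) → x∉y (subst (λ z → x ∈ W D z) (x∈⁅y⁆⇒x≡y y z≡y) x∈z)
            (inj₂ z∈X) → Low⁻ (q∩ {X} (comp⊆ x∈M)) x∈z z∈X)
          minimal : ∀ {S′ w} → w ∈ S′ → comp S′ w ⊆ M → (∀ {x} → x ∈ S′ → x ∉ W D y) →
                    ¬ Full (comp S′ w)
          -- A connected subset of `M` off the bag lies in a component for the larger segment
          -- `⁅ y ⁆ ∪ X`, and none of these is full.
          minimal {S′} {w} w∈S′ ⊆M avoid f = none (in-low (comp-self w∈S′))
            (Full-mono (λ h → ∈comp⁺ (reach-mono in-low (comp-connected (comp-self w∈S′) h))) f)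
            where
            in-low : ∀ {x} → x ∈ comp S′ w → x ∈ S ∩ Low (⁅ y ⁆ ∪ X)
            in-low h = low (⊆M h) (avoid (comp⊆ h))
          exits : ∀ {a b} → a ∈ M → Adj G a b → b ∈ S → b ∉ M → b ∈ W D y
          -- `M` meets `W D y`, since otherwise it would lie in `Low (⁅ y ⁆ ∪ X)`; thus
          -- `exit-in-bag` can start from a vertex of the bag.
          exits {a} {b} a∈M ab b∈S b∉M with Fin.any? (λ m → (m ∈? M) ×-dec (m ∈? W D y))
          ... | yes (m , m∈M , m∈y) =
            exit-in-bag o att m∈y (reach-mono (λ h → q∩ {X} (comp⊆ h)) (comp-connected m∈M a∈M)) ab
              λ b-low → b∉M (comp-step a∈M ab (x∈p∩q⁺ (b∈S , b-low)))
          ... | no disjoint = ⊥-elim (none (in-low (comp-self w∈))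
            (Full-mono (λ h → ∈comp⁺ (reach-mono in-low (comp-connected (comp-self w∈) h))) fullw))
            where
            in-low : ∀ {x} → x ∈ M → x ∈ S ∩ Low (⁅ y ⁆ ∪ X)
            in-low h = low h λ x∈y → disjoint (_ , h , x∈y)

    record Packing (k : ℕ) (S : Subset (n G)) : Set where
      field
        M         : Fin k → Subset (n G)
        M⊆S       : ∀ {i} → M i ⊆ S
        connected : ∀ i → ConnectedIn G (_∈ M i)
        nonempty  : ∀ i → ∃[ v ] v ∈ M i
        isFull    : ∀ i → Full (M i)
        disjoint  : ∀ {i j v} → v ∈ M i → v ∈ M j → i ≡ j

    record Cover (k : ℕ) (S : Subset (n G)) : Set where
      field
        nodes  : List (V (Tr D))
        size   : length nodes ≤ k
        covers : ∀ {w} → w ∈ S ─ ⋃ (map (W D) nodes) → ¬ Full (comp (S ─ ⋃ (map (W D) nodes)) w)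

    -- Induction on `k`: remove a bottleneck `M` and its bag from `S`. A packing of the rest gains
    -- `M`, a cover of the rest gains the node `y`.
    erdős-pósa : ∀ k S → Packing (suc k) S ⊎ Cover k S
    erdős-pósa k S with Fin.any? (λ w → (w ∈? S) ×-dec Full? (comp S w))
    ... | no none = inj₂ record
      { nodes = [] ; size = z≤n 
      ; covers = λ {w} w∈ f → none (w , p─q⊆p S ∅ w∈ , Full-mono (comp-mono (p─q⊆p S ∅)) f) }
    erdős-pósa zero S | yes (w , w∈S , f) = inj₁ record
      { M = λ _ → comp S w ; M⊆S = comp⊆ ; connected = λ _ → comp-connected
      ; nonempty = λ _ → w , comp-self w∈S ; isFull = λ _ → f
      ; disjoint = λ {i} {j} _ _ → only i j }
      where
      only : ∀ (i j : Fin 1) → i ≡ j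
      only zero zero = refl
    erdős-pósa (suc k) S | yes (w , w∈S , f) = extend (erdős-pósa k S′)
      where
      open Bottleneck (bottleneck w∈S f)
      S′ = S ─ (M ∪ W D y)
      extend : Packing (suc k) S′ ⊎ Cover k S′ → Packing (suc (suc k)) S ⊎ Cover (suc k) S
      extend (inj₁ P) = inj₁ record
        { M = sets
        ; M⊆S = λ {i} → inside-S i
        ; connected = λ where
            zero → connected
            (suc i) → P.connected i
        ; nonempty = λ where
            zero → nonempty
            (suc i) → P.nonempty i
        ; isFull = λ where
            zero → isFull
            (suc i) → P.isFull i
        ; disjoint = λ {i} {j} → disjoint i j }
        where
        module P = Packing P
        sets : Fin (suc (suc k)) → Subset (n G)
        sets zero = M
        sets (suc i) = P.M i
        inside-S : ∀ i → sets i ⊆ S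
        inside-S zero h = M⊆S h
        inside-S (suc i) h = p─q⊆p S _ (P.M⊆S h)
        apart : ∀ {i v} → v ∈ P.M i → v ∉ M
        apart h v∈M = proj₂ (∈─⁻ S _ (P.M⊆S h)) (x∈p∪q⁺ (inj₁ v∈M))
        disjoint : ∀ i j {v} → v ∈ sets i → v ∈ sets j → i ≡ j
        disjoint zero zero _ _ = refl
        disjoint zero (suc j) p q = ⊥-elim (apart q p)
        disjoint (suc i) zero p q = ⊥-elim (apart p q)
        disjoint (suc i) (suc j) p q = cong suc (P.disjoint p q)
      extend (inj₂ C) = inj₂ record
        { nodes = y ∷ C.nodes ; size = s≤s C.size ; covers = covers }
        where
        module C = Cover C
        B = ⋃ (map (W D) C.nodes)
        R = S ─ (W D y ∪ B)
        R⁻ : ∀ {x} → x ∈ R → x ∈ S × x ∉ W D y × x ∉ B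
        R⁻ h = let x∈S , x∉ = ∈─⁻ S _ h in x∈S , (λ q → x∉ (x∈p∪q⁺ (inj₁ q))) , (λ q → x∉ (x∈p∪q⁺ (inj₂ q)))
        covers : ∀ {w} → w ∈ R → ¬ Full (comp R w)
        covers {w} w∈R with w ∈? M
        -- Leaving `M` takes a vertex of the deleted bag, so this component lies in `M` off the bag.
        ... | yes w∈M = minimal w∈R (comp-least w∈M closed) λ h → proj₁ (proj₂ (R⁻ h))
          where
          closed : ∀ {a b} → a ∈ M → Adj G a b → b ∈ R → b ∈ M
          closed {a} {b} a∈M ab b∈R with b ∈? M
          ... | yes b∈M = b∈M
          ... | no b∉M = ⊥-elim (proj₁ (proj₂ (R⁻ b∈R)) (exits a∈M ab (proj₁ (R⁻ b∈R)) b∉M))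
        -- For the same reason a component that starts outside `M` never enters it, and it survives
        -- in `S′ ─ B`.
        ... | no w∉M = λ f → C.covers (inside-S′ (comp-self w∈R))
                (Full-mono (λ h → ∈comp⁺ (reach-mono inside-S′ (comp-connected (comp-self w∈R) h))) f)
          where
          closed : ∀ {a b} → a ∈ M → Adj G a b → a ∈ R → b ∈ R → b ∈ M
          closed {a} {b} a∈M ab _ b∈R with b ∈? M
          ... | yes b∈M = b∈M
          ... | no b∉M = ⊥-elim (proj₁ (proj₂ (R⁻ b∈R)) (exits a∈M ab (proj₁ (R⁻ b∈R)) b∉M))
          inside-S′ : ∀ {x} → x ∈ comp R w → x ∈ S′ ─ B
          inside-S′ h = let x∈S , x∉y , x∉B = R⁻ (comp⊆ h) in
            x∈p∧x∉q⇒x∈p─q (x∈p∧x∉q⇒x∈p─q x∈S λ q →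
              [ comp-avoids w∉M closed h , x∉y ]′ (x∈p∪q⁻ M (W D y) q)) x∉B

-- Minors in J_{s,t}

override : ∀ {n} {A : Set} → Subset n → A → (Fin n → A) → Fin n → A
override X a f x with x ∈? X
... | yes _ = a
... | no _  = f x

module _ {n : ℕ} {A : Set} (X : Subset n) (a : A) (f : Fin n → A) where

  override-∈ : ∀ {x} → x ∈ X → override X a f x ≡ a
  override-∈ {x} x∈X with x ∈? X
  ... | yes _ = refl
  ... | no x∉X = ⊥-elim (x∉X x∈X)

  override-∉ : ∀ {x} → x ∉ X → override X a f x ≡ f x
  override-∉ {x} x∉X with x ∈? X
  ... | yes x∈X = ⊥-elim (x∉X x∈X)
  ... | no _ = refl

  override⁻ : ∀ {x b} → override X a f x ≡ b → (x ∈ X × a ≡ b) ⊎ (x ∉ X × f x ≡ b)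
  override⁻ {x} eq with x ∈? X
  ... | yes x∈X = inj₁ (x∈X , eq)
  ... | no x∉X = inj₂ (x∉X , eq)

just? : ∀ {A : Set} (m : Maybe A) → Dec (∃[ a ] m ≡ just a)
just? (just a) = yes (a , refl)
just? nothing  = no λ ()

¬just : ∀ {A : Set} {m : Maybe A} → ¬ (∃[ a ] m ≡ just a) → m ≡ nothing
¬just {m = just a} h = ⊥-elim (h (a , refl))
¬just {m = nothing} h = refl

-- The clique side `A` in `InJ s t`, with the vertices numbered so that it comes first.
firsts : ∀ s t → Subset (s + t)
firsts zero t = ∅
firsts (suc s) t = inside Vec.∷ firsts s t

∣firsts∣ : ∀ s t → ∣ firsts s t ∣ ≡ s
∣firsts∣ zero t = ∣⊥∣≡0 t
∣firsts∣ (suc s) t = cong suc (∣firsts∣ s t)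

↑ˡ∈firsts : ∀ {s} t (i : Fin s) → (i ↑ˡ t) ∈ firsts s t
↑ˡ∈firsts t zero = Vec.here
↑ˡ∈firsts t (suc i) = Vec.there (↑ˡ∈firsts t i)

↑ʳ∉firsts : ∀ s {t} (j : Fin t) → (s ↑ʳ j) ∉ firsts s t
↑ʳ∉firsts zero j h = ∉⊥ h
↑ʳ∉firsts (suc s) j (Vec.there h) = ↑ʳ∉firsts s j h

data Split (s t : ℕ) : Fin (s + t) → Set where
  left  : (i : Fin s) → Split s t (i ↑ˡ t)
  right : (j : Fin t) → Split s t (s ↑ʳ j)

split : ∀ s t x → Split s t x
split s t x with splitAt s x | Fin.join-splitAt s t x
... | inj₁ i | refl = left i
... | inj₂ j | refl = right j

-- Used twice: for the minor, where vertices with value `nothing` are deleted, and for the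
-- partition, where every vertex has a value.
module Quotient (G : Graph) {k : ℕ} (β : V G → Maybe (Fin k)) where
  open Reachability G

  Meets : Fin k → Fin k → Set
  Meets x y = ∃[ u ] ∃[ v ] (β u ≡ just x × β v ≡ just y × Adj G u v)

  Joined : Fin k → Fin k → Set
  Joined x y = x ≢ y × Meets x y

  joined? : ∀ x y → Dec (Joined x y)
  joined? x y = ¬? (x Fin.≟ y) ×-dec Fin.any? λ u → Fin.any? λ v →
    ≡-dec Fin._≟_ (β u) (just x) ×-dec ≡-dec Fin._≟_ (β v) (just y) ×-dec Adj? u v

  Joined-sym : ∀ {x y} → Joined x y → Joined y x
  Joined-sym (x≢y , u , v , p , q , a) = ≢-sym x≢y , v , u , q , p , Adj-sym a

  quotient : Graph
  quotient = record
    { n = k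
    ; adj = λ x y → ⌊ joined? x y ⌋
    ; adj-sym = λ x y → trans (isYes≗does (joined? x y))
        (trans (does-⇔ (mk⇔ Joined-sym Joined-sym) (joined? x y) (joined? y x))
          (sym (isYes≗does (joined? y x))))
    ; adj-irr = λ x a → proj₁ (toWitness {a? = joined? x x} a) refl
    }

  Adj⁺ : ∀ {x y} → Joined x y → Adj quotient x y
  Adj⁺ {x} {y} = fromWitness {a? = joined? x y}

  Adj⁻ : ∀ {x y} → Adj quotient x y → Joined x y
  Adj⁻ {x} {y} = toWitness {a? = joined? x y}

module Growth (G : Graph) (C : Subset (n G)) (C-conn : ConnectedIn G (_∈ C)) {k : ℕ} where
  open Reachability G

  record Classes (g : V G → Maybe (Fin k)) : Set where
    field
      within    : ∀ {v j} → g v ≡ just j → v ∈ C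
      connected : ∀ j → ConnectedIn G (λ v → g v ≡ just j)

  Extends : (g g′ : V G → Maybe (Fin k)) → Set
  Extends g g′ = ∀ {v j} → g v ≡ just j → g′ v ≡ just j

  unassigned? : ∀ (g : V G → Maybe (Fin k)) v → Dec (v ∈ C × ¬ (∃[ j ] g v ≡ just j))
  unassigned? g v = (v ∈? C) ×-dec ¬? (just? (g v))

  module _ {g : V G → Maybe (Fin k)} (cls : Classes g) {a b j}
           (a∈j : g a ≡ just j) (b∉ : ¬ (∃[ j ] g b ≡ just j)) (ab : Adj G a b) (b∈C : b ∈ C) where
    open Classes cls

    g⁺ : V G → Maybe (Fin k)
    g⁺ = override ⁅ b ⁆ (just j) g

    g⁺-b : g⁺ b ≡ just j
    g⁺-b = override-∈ ⁅ b ⁆ (just j) g (x∈⁅x⁆ b)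

    g⁺⁻ : ∀ v {i} → g⁺ v ≡ just i → (v ≡ b × i ≡ j) ⊎ (g v ≡ just i)
    g⁺⁻ v eq with override⁻ ⁅ b ⁆ (just j) g eq
    ... | inj₁ (v∈ , e) = inj₁ (x∈⁅y⁆⇒x≡y b v∈ , just-injective (sym e))
    ... | inj₂ (_ , e) = inj₂ e

    g⁺-extends : Extends g g⁺
    g⁺-extends {v} e = trans (override-∉ ⁅ b ⁆ (just j) g
      λ v∈ → b∉ (_ , subst (λ v → g v ≡ _) (x∈⁅y⁆⇒x≡y b v∈) e)) e

    g⁺-connected : ∀ i → ConnectedIn G (λ v → g⁺ v ≡ just i)
    g⁺-connected i {u} {v} eu ev with g⁺⁻ u eu | g⁺⁻ v ev
    ... | inj₁ (refl , refl) | inj₁ (refl , _) = here eu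
    ... | inj₁ (refl , refl) | inj₂ ev′ = reach-sym (step (reach-mono g⁺-extends (connected j ev′ a∈j)) ab eu)
    ... | inj₂ eu′ | inj₁ (refl , refl) = step (reach-mono g⁺-extends (connected j eu′ a∈j)) ab ev
    ... | inj₂ eu′ | inj₂ ev′ = reach-mono g⁺-extends (connected i eu′ ev′)

    g⁺-classes : Classes g⁺
    g⁺-classes = record
      { within = λ {v} e → [ (λ (v≡b , _) → subst (_∈ C) (sym v≡b) b∈C) , within ]′ (g⁺⁻ v e)
      ; connected = g⁺-connected }

    g⁺-progress : ⟦ unassigned? g⁺ ⟧ ⊂ ⟦ unassigned? g ⟧
    g⁺-progress = (λ h → let v∈C , ¬g = ∈⟦⟧⁻ (unassigned? g⁺) h in
                     ∈⟦⟧⁺ (unassigned? g) (v∈C , λ (i , e) → ¬g (i , g⁺-extends e)))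
                , b , ∈⟦⟧⁺ (unassigned? g) (b∈C , b∉)
                , λ h → proj₂ (∈⟦⟧⁻ (unassigned? g⁺) h) (j , g⁺-b)

  -- While a vertex of `C` has no class, connectedness of `C` gives an edge from a classified `a` to
  -- an unclassified `b`, and `b` joins the class of `a`.
  grow : ∀ g → Classes g → (∃[ v ] ∃[ j ] g v ≡ just j) →
    ∃[ g′ ] (Classes g′ × Extends g g′ × (∀ {v} → v ∈ C → ∃[ j ] g′ v ≡ just j))
  grow g cls = go g cls (⊂-wellFounded _)
    where
    go : ∀ g → Classes g → Acc _⊂_ ⟦ unassigned? g ⟧ → (∃[ v ] ∃[ j ] g v ≡ just j) →
      ∃[ g′ ] (Classes g′ × Extends g g′ × (∀ {v} → v ∈ C → ∃[ j ] g′ v ≡ just j))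
    go g cls (acc rec) (u , i , u∈i) with Fin.any? (unassigned? g)
    ... | no none = g , cls , (λ e → e) , λ {v} v∈C → case just? (g v) of λ where
            (yes p) → p
            (no ¬p) → ⊥-elim (none (v , v∈C , ¬p))
    ... | yes (v , v∈C , ¬gv)
      with crossing (λ x → just? (g x)) (C-conn (Classes.within cls u∈i) v∈C) (i , u∈i) ¬gv
    ... | a , b , (j , a∈j) , b∉ , ab , _ , b∈C
      with go (g⁺ cls a∈j b∉ ab b∈C) (g⁺-classes cls a∈j b∉ ab b∈C)
              (rec (g⁺-progress cls a∈j b∉ ab b∈C)) (b , j , g⁺-b cls a∈j b∉ ab b∈C)
    ... | g′ , cls′ , ext , total = g′ , cls′ , (λ e → ext (g⁺-extends cls a∈j b∉ ab b∈C e)) , total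

-- The branch sets are the `s` sets of `ρ`, forming the clique, and `suc t` sets grown from the
-- `M j`. Growing them until they cover `C` makes the second side connected; that they touch every
-- set of `ρ` is inherited from `M`.
module JMinor (G : Graph) {s t : ℕ} (ρ : V G → Maybe (Fin s)) (C : Subset (n G))
  (C-conn : ConnectedIn G (_∈ C))
  (ρ-outside : ∀ {v i} → ρ v ≡ just i → v ∉ C)
  (ρ-connected : ∀ i → ConnectedIn G (λ v → ρ v ≡ just i))
  (ρ-adjacent : ∀ {i j} → i ≢ j → ∃[ u ] ∃[ v ] (ρ u ≡ just i × ρ v ≡ just j × Adj G u v))
  (M : Fin (suc t) → Subset (n G))
  (M⊆C : ∀ {j} → M j ⊆ C)
  (M-connected : ∀ j → ConnectedIn G (_∈ M j))
  (M-nonempty : ∀ j → ∃[ v ] v ∈ M j)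
  (M-disjoint : ∀ {i j v} → v ∈ M i → v ∈ M j → i ≡ j)
  (M-touches : ∀ j i → ∃[ x ] ∃[ u ] (x ∈ M j × ρ u ≡ just i × Adj G x u)) where

  open Reachability G
  open Growth G C C-conn {suc t}

  g₀ : V G → Maybe (Fin (suc t))
  g₀ v with Fin.any? (λ j → v ∈? M j)
  ... | yes (j , _) = just j
  ... | no _ = nothing

  g₀⁺ : ∀ {v j} → v ∈ M j → g₀ v ≡ just j
  g₀⁺ {v} v∈j with Fin.any? (λ j → v ∈? M j)
  ... | yes (i , v∈i) = cong just (M-disjoint v∈i v∈j)
  ... | no none = ⊥-elim (none (_ , v∈j))

  g₀⁻ : ∀ {v j} → g₀ v ≡ just j → v ∈ M j
  g₀⁻ {v} e with Fin.any? (λ j → v ∈? M j)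
  g₀⁻ refl | yes (_ , v∈j) = v∈j

  g₀-classes : Classes g₀
  g₀-classes = record
    { within = λ e → M⊆C (g₀⁻ e)
    ; connected = λ j eu ev → reach-mono g₀⁺ (M-connected j (g₀⁻ eu) (g₀⁻ ev)) }

  grown : ∃[ g ] (Classes g × Extends g₀ g × (∀ {v} → v ∈ C → ∃[ j ] g v ≡ just j))
  grown = grow g₀ g₀-classes (let v , v∈ = M-nonempty zero in v , zero , g₀⁺ v∈)

  module Contracted (g : V G → Maybe (Fin (suc t))) (cls : Classes g) (ext : Extends g₀ g)
                    (total : ∀ {v} → v ∈ C → ∃[ j ] g v ≡ just j) where
    open Classes cls

    merge : Maybe (Fin (suc t)) → Maybe (Fin s) → Maybe (Fin (s + suc t))
    merge (just j) _ = just (s ↑ʳ j)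
    merge nothing r = Maybe.map (_↑ˡ suc t) r

    β : V G → Maybe (Fin (s + suc t))
    β v = merge (g v) (ρ v)

    βʳ⁺ : ∀ {v j} → g v ≡ just j → β v ≡ just (s ↑ʳ j)
    βʳ⁺ {v} e rewrite e = refl

    βˡ⁺ : ∀ {v i} → ρ v ≡ just i → β v ≡ just (i ↑ˡ suc t)
    βˡ⁺ {v} {i} e rewrite ¬just {m = g v} (λ (_ , q) → ρ-outside e (within q)) | e = refl

    βʳ⁻ : ∀ {v j} → β v ≡ just (s ↑ʳ j) → g v ≡ just j
    βʳ⁻ {v} {j} e with g v | ρ v
    ... | just k  | _       = cong just (Fin.↑ʳ-injective s k j (just-injective e))
    ... | nothing | just i  = ⊥-elim (↑ʳ∉firsts s j
            (subst (_∈ firsts s (suc t)) (just-injective e) (↑ˡ∈firsts (suc t) i)))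

    βˡ⁻ : ∀ {v i} → β v ≡ just (i ↑ˡ suc t) → ρ v ≡ just i
    βˡ⁻ {v} {i} e with g v | ρ v
    ... | just k  | _       = ⊥-elim (↑ʳ∉firsts s k
            (subst (_∈ firsts s (suc t)) (sym (just-injective e)) (↑ˡ∈firsts (suc t) i)))
    ... | nothing | just k = cong just (Fin.↑ˡ-injective (suc t) k i (just-injective e))

    open Quotient G β

    isMinor : IsMinor quotient G
    isMinor = β , nonempty , conn , λ x y a → proj₂ (Adj⁻ a)
      where
      nonempty : ∀ x → ∃[ v ] β v ≡ just x
      nonempty x with split s (suc t) x
      -- A set of `ρ` is nonempty because `M zero` touches it.
      ... | left i  = let _ , u , _ , e , _ = M-touches zero i in u , βˡ⁺ e
      ... | right j = let v , v∈ = M-nonempty j in v , βʳ⁺ (ext (g₀⁺ v∈))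
      conn : ∀ x → ConnectedIn G (λ v → β v ≡ just x)
      conn x eu ev with split s (suc t) x
      ... | left i  = reach-mono βˡ⁺ (ρ-connected i (βˡ⁻ eu) (βˡ⁻ ev))
      ... | right j = reach-mono βʳ⁺ (connected j (βʳ⁻ eu) (βʳ⁻ ev))

    private A = firsts s (suc t)

    -- An edge of the walk inside one class is dropped; an edge between two classes becomes an edge
    -- of the quotient.
    B-reach : ∀ {u v i j} → Reach G (_∈ C) u v → g u ≡ just i → g v ≡ just j →
      Reach quotient (_∉ A) (s ↑ʳ i) (s ↑ʳ j)
    B-reach {i = i} (here _) eu ev with just-injective (trans (sym eu) ev)
    ... | refl = here (↑ʳ∉firsts s i)
    B-reach {v = v} {j = j} (step {w = w} r a v∈C) eu ev with total (end r)
    ... | k , ew with k Fin.≟ j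
    ... | yes refl = B-reach r eu ew
    ... | no k≢j = step (B-reach r eu ew)
            (Adj⁺ ((λ e → k≢j (Fin.↑ʳ-injective s k j e)) , w , v , βʳ⁺ ew , βʳ⁺ ev , a)) (↑ʳ∉firsts s j)

    inJ : InJ s (suc t) quotient
    inJ = A , refl , ∣firsts∣ s (suc t) , clique , joined , conn
      where
      clique : ∀ x y → x ∈ A → y ∈ A → x ≢ y → Adj quotient x y
      clique x y x∈A y∈A x≢y with split s (suc t) x | split s (suc t) y
      ... | right j | _ = ⊥-elim (↑ʳ∉firsts s j x∈A)
      ... | left _ | right j = ⊥-elim (↑ʳ∉firsts s j y∈A)
      ... | left i | left j =
        let u , v , eu , ev , a = ρ-adjacent {i} {j} (λ i≡j → x≢y (cong (_↑ˡ suc t) i≡j)) in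
        Adj⁺ (x≢y , u , v , βˡ⁺ eu , βˡ⁺ ev , a)
      joined : ∀ x y → x ∈ A → y ∉ A → Adj quotient x y
      joined x y x∈A y∉A with split s (suc t) x | split s (suc t) y
      ... | right j | _ = ⊥-elim (↑ʳ∉firsts s j x∈A)
      ... | left _ | left i = ⊥-elim (y∉A (↑ˡ∈firsts (suc t) i))
      ... | left i | right j =
        let v , u , v∈ , eu , a = M-touches j i in
        Adj⁺ ((λ e → y∉A (subst (_∈ A) e x∈A)) , u , v , βˡ⁺ eu , βʳ⁺ (ext (g₀⁺ v∈)) , Adj-sym a)
      conn : ConnectedIn quotient (_∉ A)
      conn {x} {y} x∉A y∉A with split s (suc t) x | split s (suc t) y
      ... | left i | _ = ⊥-elim (x∉A (↑ˡ∈firsts (suc t) i))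
      ... | right _ | left i = ⊥-elim (y∉A (↑ˡ∈firsts (suc t) i))
      ... | right i | right j =
        let u , u∈ = M-nonempty i ; v , v∈ = M-nonempty j in
        B-reach (C-conn (M⊆C u∈) (M⊆C v∈)) (ext (g₀⁺ u∈)) (ext (g₀⁺ v∈))

  minor-contradiction : JMinorFree s (suc t) G → ⊥
  minor-contradiction free = let g , cls , ext , total = grown in
    free _ (Contracted.inJ g cls ext total) (Contracted.isMinor g cls ext total)

-- Choosing a part

module Touching (G : Graph) {s : ℕ} (ρ : V G → Maybe (Fin s)) where
  open Reachability G

  Touch : Subset (n G) → Fin s → Set
  Touch S i = ∃[ x ] ∃[ u ] (x ∈ S × ρ u ≡ just i × Adj G x u)

  touch? : ∀ S i → Dec (Touch S i)
  touch? S i = Fin.any? λ x → Fin.any? λ u →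
    (x ∈? S) ×-dec ≡-dec Fin._≟_ (ρ u) (just i) ×-dec Adj? x u

  touch-mono : ∀ {S S′ i} → S ⊆ S′ → Touch S i → Touch S′ i
  touch-mono S⊆S′ (x , u , x∈S , rest) = x , u , S⊆S′ x∈S , rest

module Splitting {G : Graph} (D : TreeDecomposition G) {s ℓ : ℕ} (1≤ℓ : 1 ≤ ℓ)
  (free : JMinorFree s (suc ℓ) G) (C : Subset (n G)) (C-conn : ConnectedIn G (_∈ C))
  {v₀ : V G} (v₀∈C : v₀ ∈ C) (ρ : V G → Maybe (Fin s)) where
  open Reachability G

  open Touching G ρ

  Full : Subset (n G) → Set
  Full S = ∀ i → Touch C i → Touch S i

  Full-mono : ∀ {S S′} → S ⊆ S′ → Full S → Full S′
  Full-mono S⊆S′ f i t = touch-mono S⊆S′ (f i t)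

  Misses : Subset (n G) → Fin s → Set
  Misses S i = Touch C i × ¬ Touch S i

  misses? : ∀ S i → Dec (Misses S i)
  misses? S i = touch? C i ×-dec ¬? (touch? S i)

  Full? : ∀ S → Dec (Full S)
  Full? S = Fin.all? λ i → touch? C i →-dec touch? S i

  ¬Full⇒misses : ∀ {S} → ¬ Full S → ∃[ i ] Misses S i
  ¬Full⇒misses {S} ¬f with Fin.any? (misses? S)
  ... | yes m = m
  ... | no none = ⊥-elim (¬f λ i t → case touch? S i of λ where
          (yes t′) → t′
          (no ¬t) → ⊥-elim (none (i , t , ¬t)))

  piece : Subset (n G) → V G → Subset (n G)
  piece P w = comp (C ─ P) w

  C─ : ∀ {P x} → x ∈ C → x ∉ P → x ∈ C ─ P
  C─ = x∈p∧x∉q⇒x∈p─q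

  -- Here `N` is to replace the untouched `R i` in the context of `K`: it contains the new part, and
  -- fullness keeps it adjacent to the touched sets.
  record Spare (P K : Subset (n G)) : Set where
    field
      i         : Fin s
      untouched : ¬ Touch C i
      N         : Subset (n G)
      connected : ConnectedIn G (_∈ N)
      nonempty  : ∃[ x ] x ∈ N
      N⊆C       : N ⊆ C
      P⊆N       : P ⊆ N
      avoids    : ∀ {x} → x ∈ K → x ∉ N
      isFull    : Full N

  spare-mono : ∀ {P P′ K K′} → P′ ⊆ P → K′ ⊆ K → Spare P K → Spare P′ K′
  spare-mono P′⊆P K′⊆K S = record
    { i = i ; untouched = untouched ; N = N ; connected = connected ; nonempty = nonempty
    ; N⊆C = N⊆C ; P⊆N = λ h → P⊆N (P′⊆P h) ; avoids = λ h → avoids (K′⊆K h) ; isFull = isFull }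
    where open Spare S

  -- What the first choice of `P` delivers and shrinking preserves: for every component of `C ─ P`
  -- some index is available to the new part.
  Loose : Subset (n G) → Set
  Loose P = ∀ {w} → w ∈ C ─ P → (∃[ i ] Misses (piece P w) i) ⊎ Spare P (piece P w)

  -- The obstruction to `R i ∪ (C ─ K)` being connected: a component of `C ─ K` without an edge to
  -- `R i`.
  Flaw : Subset (n G) → V G → Fin s → V G → Set
  Flaw P w i q = w ∈ C ─ P × Misses (piece P w) i × q ∈ C ─ piece P w × ¬ Touch (comp (C ─ piece P w) q) i

  Tight : Subset (n G) → Set
  Tight P = ∀ {w i q} → ¬ Flaw P w i q

  flaw? : ∀ P → Dec (∃[ w ] ∃[ i ] ∃[ q ] Flaw P w i q)
  flaw? P = Fin.any? λ w → Fin.any? λ i → Fin.any? λ q →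
    (w ∈? C ─ P) ×-dec misses? (piece P w) i ×-dec (q ∈? C ─ piece P w)
      ×-dec ¬? (touch? (comp (C ─ piece P w) q) i)

  module Repair {P : Subset (n G)} (loose : Loose P) {w i q} (flaw : Flaw P w i q) where
    K = piece P w
    Q = comp (C ─ K) q

    w∈ : w ∈ C ─ P
    w∈ = proj₁ flaw

    q∈ : q ∈ C ─ K
    q∈ = proj₁ (proj₂ (proj₂ flaw))

    Q⁻ : ∀ {x} → x ∈ Q → x ∈ C × x ∉ K
    Q⁻ h = ∈─⁻ C K (comp⊆ h)

    -- An edge of the connected set `C` leaves `Q`. Its end `a` in `Q` lies in `P`, since otherwise
    -- its other end `b` would force `a ∈ K` or `b ∈ Q`. Hence removing `Q` from `P` makes progress.
    P∩Q : ∃[ x ] x ∈ P ∩ Q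
    P∩Q with crossing (_∈? Q) (C-conn (proj₁ (Q⁻ (comp-self q∈))) (proj₁ (∈─⁻ C P w∈)))
               (comp-self q∈) (λ w∈Q → proj₂ (Q⁻ w∈Q) (comp-self w∈))
    ... | a , b , a∈Q , b∉Q , ab , a∈C , b∈C with a ∈? P
    ... | yes a∈P = a , x∈p∩q⁺ (a∈P , a∈Q)
    ... | no a∉P with b ∈? K
    ... | yes b∈K = ⊥-elim (proj₂ (Q⁻ a∈Q) (comp-step b∈K (Adj-sym ab) (C─ a∈C a∉P)))
    ... | no b∉K = ⊥-elim (b∉Q (comp-step a∈Q ab (C─ b∈C b∉K)))

    P′ = P ─ Q

    P′⊂P : P′ ⊂ P
    P′⊂P = p∩q≢∅⇒p─q⊂p P Q P∩Q

    -- A neighbour of `K` in `C ─ P′` is in `Q`, or else outside `P` and hence in `K`; a neighbour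
    -- of `Q` in `C` is in `K` or in `Q`.
    closed : ∀ {a b} → a ∈ K ∪ Q → Adj G a b → b ∈ C ─ P′ → b ∈ K ∪ Q
    closed {a} {b} a∈ ab b∈ with b ∈? K | b ∈? Q
    ... | yes b∈K | _ = x∈p∪q⁺ (inj₁ b∈K)
    ... | no _ | yes b∈Q = x∈p∪q⁺ (inj₂ b∈Q)
    ... | no b∉K | no b∉Q = ⊥-elim ([ (λ a∈K → b∉K (comp-step a∈K ab (C─ b∈C b∉P)))
                                    , (λ a∈Q → b∉Q (comp-step a∈Q ab (C─ b∈C b∉K))) ]′ (x∈p∪q⁻ K Q a∈))
      where
      b∈C = proj₁ (∈─⁻ C P′ b∈)
      b∉P : b ∉ P
      b∉P b∈P = proj₂ (∈─⁻ C P′ b∈) (x∈p∧x∉q⇒x∈p─q b∈P b∉Q)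

    -- A component that starts in `K ∪ Q` stays there and misses `i`, as `K` and `Q` do. Any other
    -- component is contained in an old one and inherits its alternative.
    still-loose : Loose P′
    still-loose {x} x∈ with x ∈? K ∪ Q
    ... | yes x∈KQ = inj₁ (i , proj₁ (proj₁ (proj₂ flaw)) , λ (y , u , y∈ , rest) →
      [ (λ y∈K → proj₂ (proj₁ (proj₂ flaw)) (y , u , y∈K , rest))
      , (λ y∈Q → proj₂ (proj₂ (proj₂ flaw)) (y , u , y∈Q , rest)) ]′
      (x∈p∪q⁻ K Q (comp-least x∈KQ closed y∈)))
    ... | no x∉KQ = [ (λ (j , t , ¬t) → inj₁ (j , t , λ t′ → ¬t (touch-mono smaller t′)))
                    , (λ S → inj₂ (spare-mono (proj₁ P′⊂P) smaller S)) ]′ (loose (in-C─P (comp-self x∈)))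
      where
      in-C─P : ∀ {y} → y ∈ piece P′ x → y ∈ C ─ P
      in-C─P h with ∈─⁻ C P′ (comp⊆ h)
      ... | y∈C , y∉P′ = C─ y∈C λ y∈P → y∉P′ (x∈p∧x∉q⇒x∈p─q y∈P λ y∈Q →
              comp-avoids x∉KQ (λ a∈ ab _ b∈ → closed a∈ ab b∈) h (x∈p∪q⁺ (inj₂ y∈Q)))
      smaller : piece P′ x ⊆ piece P x
      smaller h = ∈comp⁺ (reach-mono in-C─P (comp-connected (comp-self x∈) h))

  tighten : ∀ P → Loose P → ∃[ P′ ] (P′ ⊆ P × Loose P′ × Tight P′)
  tighten P loose = go P loose (⊂-wellFounded P)
    where
    go : ∀ P → Loose P → Acc _⊂_ P → ∃[ P′ ] (P′ ⊆ P × Loose P′ × Tight P′)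
    go P loose (acc rec) with flaw? P
    ... | no none = P , (λ h → h) , loose , λ f → none (_ , _ , _ , f)
    ... | yes (_ , _ , _ , f) =
      let P″ , P″⊆ , rest = go P′ still-loose (rec P′⊂P) in P″ , (λ h → proj₁ P′⊂P (P″⊆ h)) , rest
      where open Repair loose f

  -- If `P` were empty, the component would be `C` itself, which misses nothing that it touches and
  -- cannot be avoided by a nonempty `N ⊆ C`.
  loose⇒nonempty : ∀ {P} → Loose P → ∃[ x ] x ∈ P
  loose⇒nonempty {P} loose with nonempty? P
  ... | yes p = p
  ... | no empty = ⊥-elim ([ (λ (_ , t , ¬t) → ¬t (touch-mono C⊆ t))
                           , (λ S → let open Spare S ; _ , x∈N = nonempty in avoids (C⊆ (N⊆C x∈N)) x∈N) ]′
                           (loose (all v₀∈C)))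
    where
    all : ∀ {x} → x ∈ C → x ∈ C ─ P
    all x∈C = C─ x∈C λ x∈P → empty (_ , x∈P)
    C⊆ : C ⊆ piece P v₀
    C⊆ h = ∈comp⁺ (reach-mono all (C-conn v₀∈C h))

  module _ (ρ-outside : ∀ {v i} → ρ v ≡ just i → v ∉ C)
           (ρ-connected : ∀ i → Touch C i → ConnectedIn G (λ v → ρ v ≡ just i))
           (ρ-adjacent : ∀ {i j} → i ≢ j → Touch C i → Touch C j →
                         ∃[ u ] ∃[ v ] (ρ u ≡ just i × ρ v ≡ just j × Adj G u v)) where

    open Bottlenecks D hiding (module Bottleneck; module Packing; module Cover)

    record Initial : Set where
      field
        P     : Subset (n G)
        P⊆C   : P ⊆ C
        nodes : List (V (Tr D))
        size  : length nodes ≤ ℓ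
        P⊆W   : P ⊆ ⋃ (map (W D) nodes)
        loose : Loose P

    initial-all : (∀ i → Touch C i) → Initial
    initial-all touched with erdős-pósa Full Full? Full-mono ℓ C
    ... | inj₁ p = ⊥-elim (JMinor.minor-contradiction G ρ C C-conn ρ-outside
            (λ i → ρ-connected i (touched i)) (λ i≢j → ρ-adjacent i≢j (touched _) (touched _))
            M M⊆S connected nonempty disjoint (λ j i → isFull j i (touched i)) free)
      where open Bottlenecks.Packing p
    ... | inj₂ c = record
      { P = C ∩ B ; P⊆C = p∩q⊆p C B ; nodes = nodes ; size = size ; P⊆W = p∩q⊆q C B
      ; loose = λ w∈ → inj₁ (¬Full⇒misses λ f → covers (shrink w∈) (Full-mono (comp-mono shrink) f)) }
      where
      open Bottlenecks.Cover c
      B = ⋃ (map (W D) nodes)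
      shrink : C ─ (C ∩ B) ⊆ C ─ B
      shrink h = let x∈C , x∉ = ∈─⁻ C _ h in C─ x∈C λ x∈B → x∉ (x∈p∩q⁺ (x∈C , x∈B))

    initial-spare : ∀ i → ¬ Touch C i → Initial
    initial-spare i untouched = record
      -- A single bag is used; here `t ≥ 2` enters.
      { P = P ; P⊆C = λ h → N⊆C (P⊆N h) ; nodes = y ∷ [] ; size = 1≤ℓ
      ; P⊆W = λ h → x∈p∪q⁺ (inj₁ (p∩q⊆p _ N h)) ; loose = loose }
      where
      open Bottlenecks.Bottleneck (bottleneck Full Full? Full-mono v₀∈C
        (λ j → touch-mono λ h → ∈comp⁺ (C-conn v₀∈C h)))
      near? : ∀ x → Dec (x ∈ C × (x ∈ M ⊎ ∃[ m ] (m ∈ M × Adj G m x)))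
      near? x = (x ∈? C) ×-dec ((x ∈? M) ⊎-dec Fin.any? λ m → (m ∈? M) ×-dec Adj? m x)
      -- Taking the closed neighbourhood of `M` in `C` keeps `N` connected, and `exits` puts `N`
      -- minus `M` inside `P`.
      N = ⟦ near? ⟧
      P = W D y ∩ N
      P⊆N : P ⊆ N
      P⊆N = p∩q⊆q _ N
      N⊆C : N ⊆ C
      N⊆C h = proj₁ (∈⟦⟧⁻ near? h)
      M⊆N : M ⊆ N
      M⊆N h = ∈⟦⟧⁺ near? (M⊆S h , inj₁ h)
      N∖M : ∀ {x} → x ∈ N → x ∉ M → x ∈ P
      N∖M {x} h x∉M with ∈⟦⟧⁻ near? h
      ... | _ , inj₁ x∈M = ⊥-elim (x∉M x∈M)
      ... | x∈C , inj₂ (m , m∈M , a) = x∈p∩q⁺ (exits m∈M a x∈C x∉M , h)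
      neighbour : ∀ {a b} → a ∈ M → Adj G a b → b ∈ C → b ∈ N
      neighbour a∈M ab b∈C = ∈⟦⟧⁺ near? (b∈C , inj₂ (_ , a∈M , ab))
      to-M : ∀ {x} → x ∈ N → ∃[ m ] (m ∈ M × Reach G (_∈ N) x m)
      to-M {x} h with ∈⟦⟧⁻ near? h
      ... | _ , inj₁ x∈M = x , x∈M , here h
      ... | _ , inj₂ (m , m∈M , a) = m , m∈M , step (here h) (Adj-sym a) (M⊆N m∈M)
      N-connected : ConnectedIn G (_∈ N)
      N-connected p q = let m , m∈M , r = to-M p ; m′ , m′∈M , r′ = to-M q in
        reach-trans r (reach-trans (reach-mono M⊆N (connected m∈M m′∈M)) (reach-sym r′))
      loose : Loose P
      loose {w} w∈ with w ∈? M
      ... | yes w∈M = inj₁ (¬Full⇒misses λ f →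
              -- `minimal` asks for a set off the bag, which `C ─ P` need not be; so it is applied
              -- to the piece, which lies in `M`.
              minimal (comp-self w∈) (λ h → in-M (comp⊆ h)) off
                (Full-mono (λ h → ∈comp⁺ (comp-connected (comp-self w∈) h)) f))
        where
        closed : ∀ {a b} → a ∈ M → Adj G a b → b ∈ C ─ P → b ∈ M
        closed {a} {b} a∈M ab b∈ with b ∈? M
        ... | yes b∈M = b∈M
        ... | no b∉M = let b∈C , b∉P = ∈─⁻ C P b∈ in ⊥-elim (b∉P (N∖M (neighbour a∈M ab b∈C) b∉M))
        in-M : piece P w ⊆ M
        in-M = comp-least w∈M closed
        off : ∀ {x} → x ∈ piece P w → x ∉ W D y
        off h x∈y = proj₂ (∈─⁻ C P (comp⊆ h)) (x∈p∩q⁺ (x∈y , M⊆N (in-M h)))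
      ... | no w∉M = inj₂ record
        { i = i ; untouched = untouched ; N = N ; connected = N-connected
        ; nonempty = let m , m∈M = nonempty in m , M⊆N m∈M
        ; N⊆C = N⊆C ; P⊆N = P⊆N
        -- `w` is outside `N`, and an edge leaving `N` inside `C ─ P` would start in `M`, whose
        -- neighbours in `C` all belong to `N`.
        ; avoids = comp-avoids (λ w∈N → proj₂ (∈─⁻ C P w∈) (N∖M w∈N w∉M)) closed
        ; isFull = Full-mono M⊆N isFull }
        where
        closed : ∀ {a b} → a ∈ N → Adj G a b → a ∈ C ─ P → b ∈ C ─ P → b ∈ N
        closed {a} {b} a∈N ab a∈ b∈ with a ∈? M
        ... | yes a∈M = neighbour a∈M ab (proj₁ (∈─⁻ C P b∈))
        ... | no a∉M = ⊥-elim (proj₂ (∈─⁻ C P a∈) (N∖M a∈N a∉M))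

    opaque
      initial : Initial
      initial with Fin.any? (λ i → ¬? (touch? C i))
      ... | yes (i , ¬t) = initial-spare i ¬t
      ... | no none = initial-all λ i → case touch? C i of λ where
              (yes t) → t
              (no ¬t) → ⊥-elim (none (i , ¬t))

    -- What `K` needs for its own context: a set `R` replacing the `i`-th one. `origin` keeps `R`
    -- disjoint from the other sets, `adjacent` keeps the touched sets pairwise adjacent.
    record Slot (P K : Subset (n G)) : Set where
      field
        i         : Fin s
        missed    : ¬ Touch K i
        R         : Subset (n G)
        connected : ConnectedIn G (_∈ R)
        P⊆R       : P ⊆ R
        avoids    : ∀ {x} → x ∈ K → x ∉ R
        adjacent  : ∀ {j} → j ≢ i → Touch K j → Touch R j
        origin    : ∀ {x} → x ∈ R → x ∈ C ⊎ ρ x ≡ just i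

    -- A spare supplies its own `N`. Otherwise `R i ∪ (C ─ K)` serves: by tightness every component
    -- of `C ─ K` has an edge to the connected set `R i`.
    slot : ∀ {P} → P ⊆ C → Loose P → Tight P → ∀ {w} → w ∈ C ─ P → Slot P (piece P w)
    slot {P} P⊆C loose tight {w} w∈ with loose w∈
    ... | inj₂ S = record
      { i = i ; missed = λ t → untouched (touch-mono K⊆C t) ; R = N ; connected = connected
      ; P⊆R = P⊆N ; avoids = avoids ; adjacent = λ _ t → isFull _ (touch-mono K⊆C t)
      ; origin = λ h → inj₁ (N⊆C h) }
      where
      open Spare S
      K⊆C : piece P w ⊆ C
      K⊆C h = p─q⊆p C P (comp⊆ h)
    ... | inj₁ (i , t , ¬t) = record
      { i = i ; missed = ¬t ; R = R ; connected = R-connected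
      ; P⊆R = λ h → right⊆ (C─ (P⊆C h) λ h′ → proj₂ (∈─⁻ C P (comp⊆ h′)) h)
      ; avoids = λ h h′ → [ (λ e → ρ-outside (∈⟦⟧⁻ at? e) (K⊆C h))
                         , (λ q → proj₂ (∈─⁻ C K q) h) ]′ (x∈p∪q⁻ _ _ h′)
      ; adjacent = λ j≢i tj → let u , v , eu , ev , a = ρ-adjacent (≢-sym j≢i) t (touch-mono K⊆C tj) in
          u , v , left⊆ eu , ev , a
      ; origin = λ h → [ (λ e → inj₂ (∈⟦⟧⁻ at? e)) , (λ q → inj₁ (p─q⊆p C K q)) ]′ (x∈p∪q⁻ _ _ h) }
      where
      K = piece P w
      K⊆C : K ⊆ C
      K⊆C h = p─q⊆p C P (comp⊆ h)
      at? : ∀ v → Dec (ρ v ≡ just i)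
      at? v = ≡-dec Fin._≟_ (ρ v) (just i)
      R = ⟦ at? ⟧ ∪ (C ─ K)
      left⊆ : ∀ {v} → ρ v ≡ just i → v ∈ R
      left⊆ e = x∈p∪q⁺ (inj₁ (∈⟦⟧⁺ at? e))
      right⊆ : C ─ K ⊆ R
      right⊆ h = x∈p∪q⁺ (inj₂ h)
      to-ρ : ∀ {x} → x ∈ R → ∃[ u ] (ρ u ≡ just i × Reach G (_∈ R) x u)
      to-ρ {x} x∈R with x∈p∪q⁻ ⟦ at? ⟧ _ x∈R
      ... | inj₁ e = x , ∈⟦⟧⁻ at? e , here x∈R
      ... | inj₂ x∈ with touch? (comp (C ─ K) x) i
      ... | no ¬tx = ⊥-elim (tight (w∈ , (t , ¬t) , x∈ , ¬tx))
      ... | yes (z , u , z∈ , e , a) = u , e , step (reach-mono right⊆ (∈comp⁻ z∈)) a (left⊆ e)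
      R-connected : ConnectedIn G (_∈ R)
      R-connected p q = let u , e , r = to-ρ p ; u′ , e′ , r′ = to-ρ q in
        reach-trans r (reach-trans (reach-mono left⊆ (ρ-connected i t e e′)) (reach-sym r′))

    record Cut : Set where
      field
        P        : Subset (n G)
        P⊆C      : P ⊆ C
        nonempty : ∃[ x ] x ∈ P
        nodes    : List (V (Tr D))
        size     : length nodes ≤ ℓ
        P⊆W      : P ⊆ ⋃ (map (W D) nodes)
        slots    : ∀ {w} → w ∈ C ─ P → Slot P (piece P w)

    opaque
      cut : Cut
      cut = let open Initial initial ; P′ , P′⊆P , l , t = tighten P loose in record
        { P = P′ ; P⊆C = λ h → P⊆C (P′⊆P h) ; nonempty = loose⇒nonempty l
        ; nodes = nodes ; size = size ; P⊆W = λ h → P⊆W (P′⊆P h)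
        ; slots = slot (λ h → P⊆C (P′⊆P h)) l t }

-- Trees given by parent functions

module ParentTree (m : ℕ) (par : ℕ → ℕ) (par≤ : ∀ {q} → q < m → par (suc q) ≤ q) where

  private
    Node = Fin (suc m)

  -- Node 0 is the root; `0 < toℕ x` keeps the value `par 0` from making it a child.
  Child : Node → Node → Set
  Child x y = 0 < toℕ x × par (toℕ x) ≡ toℕ y

  child? : ∀ x y → Dec (Child x y)
  child? x y = (0 <? toℕ x) ×-dec (par (toℕ x) ℕ.≟ toℕ y)

  Child-< : ∀ {x y} → Child x y → toℕ y < toℕ x
  Child-< {suc x} (_ , e) = s≤s (subst (_≤ toℕ x) e (par≤ (Fin.toℕ<n x)))

  parent : ∀ (x : Fin m) → ∃[ y ] (Child (suc x) y × toℕ y ≡ par (suc (toℕ x)))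
  parent x = fromℕ< lt , (s≤s z≤n , sym (Fin.toℕ-fromℕ< lt)) , Fin.toℕ-fromℕ< lt
    where
    lt : par (suc (toℕ x)) < suc m
    lt = s≤s (ℕ.≤-trans (par≤ (Fin.toℕ<n x)) (ℕ.<⇒≤ (Fin.toℕ<n x)))

  Edge : Node → Node → Set
  Edge x y = Child x y ⊎ Child y x

  edge? : ∀ x y → Dec (Edge x y)
  edge? x y = child? x y ⊎-dec child? y x

  Edge-sym : ∀ {x y} → Edge x y → Edge y x
  Edge-sym = [ inj₂ , inj₁ ]′

  tree : Graph
  tree = record
    { n = suc m
    ; adj = λ x y → ⌊ edge? x y ⌋
    ; adj-sym = λ x y → trans (isYes≗does (edge? x y))
        (trans (does-⇔ (mk⇔ Edge-sym Edge-sym) (edge? x y) (edge? y x)) (sym (isYes≗does (edge? y x))))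
    ; adj-irr = λ x a → [ (λ c → ℕ.<-irrefl refl (Child-< c)) , (λ c → ℕ.<-irrefl refl (Child-< c)) ]′
        (toWitness {a? = edge? x x} a)
    }

  open Reachability tree

  edge⁻ : ∀ {x y} → Adj tree x y → Edge x y
  edge⁻ {x} {y} = toWitness {a? = edge? x y}

  -- Parents have smaller numbers, so the ascent within `S` stops, and it can only stop at `r`.
  climb : ∀ (S : Node → Set) r → (∀ {x} → S x → x ≢ r → ∃[ y ] (Child x y × S y)) →
    ∀ {x} → S x → Reach tree S x r
  climb S r up {x} Sx = go x (<-wellFounded (toℕ x)) Sx
    where
    go : ∀ x → Acc _<_ (toℕ x) → S x → Reach tree S x r
    go x (acc rec) Sx with x Fin.≟ r
    ... | yes refl = here Sx
    ... | no x≢r with up Sx x≢r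
    ... | y , c , Sy = reach-trans
      (step (here Sx) (fromWitness {a? = edge? x y} (inj₁ c)) Sy) (go y (rec (Child-< c)) Sy)

  -- The local consequence of distinctness on which the inductions in `descending` and `last-step`
  -- run.
  NonBacktracking : List Node → Set
  NonBacktracking (a ∷ b ∷ c ∷ l) = a ≢ c × NonBacktracking (b ∷ c ∷ l)
  NonBacktracking _ = ⊤

  unique⇒nonBacktracking : ∀ a l z → Unique (a ∷ l) → All (z ≢_) (a ∷ l) →
    NonBacktracking (a ∷ l ++ [ z ])
  unique⇒nonBacktracking a [] z _ _ = tt
  unique⇒nonBacktracking a (b ∷ []) z _ (z≢a ∷ _) = ≢-sym z≢a , tt
  unique⇒nonBacktracking a (b ∷ c ∷ l) z ((_ ∷ a≢c ∷ _) ∷ u) (_ ∷ z≢) =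
    a≢c , unique⇒nonBacktracking b (c ∷ l) z u z≢

  same-parent : ∀ {x y z} → Child x y → Child x z → y ≡ z
  same-parent (_ , p) (_ , q) = Fin.toℕ-injective (trans (sym p) q)

  -- After a downward step, an upward one would return to the unique parent and so backtrack; hence
  -- the walk descends to its end.
  descending : ∀ a b l z → Child b a → Linked tree (b ∷ l ++ [ z ]) →
    NonBacktracking (a ∷ b ∷ l ++ [ z ]) → Child z (last b l) × toℕ a < toℕ z
  descending a b [] z ba (bz , _) (a≢z , _) with edge⁻ {b} {z} bz
  ... | inj₁ c = ⊥-elim (a≢z (same-parent ba c))
  ... | inj₂ c = c , ℕ.<-trans (Child-< ba) (Child-< c)
  descending a b (d ∷ l) z ba (bd , k) (a≢d , nb) with edge⁻ {b} {d} bd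
  ... | inj₁ c = ⊥-elim (a≢d (same-parent ba c))
  ... | inj₂ c = let e , lt = descending b d l z c k nb in e , ℕ.<-trans (Child-< ba) lt

  -- Once a step goes down, so does the last one; if all steps go up, the numbers decrease.
  last-step : ∀ a l z → Linked tree (a ∷ l ++ [ z ]) → NonBacktracking (a ∷ l ++ [ z ]) →
    Child z (last a l) ⊎ toℕ z < toℕ a
  last-step a [] z (az , _) _ with edge⁻ {a} {z} az
  ... | inj₁ c = inj₂ (Child-< c)
  ... | inj₂ c = inj₁ c
  last-step a (b ∷ l) z (ab , k) nb with edge⁻ {a} {b} ab
  ... | inj₂ c = inj₁ (proj₁ (descending a b l z c k nb))
  ... | inj₁ c with last-step b l z k (tail l nb)
    where
    tail : ∀ l → NonBacktracking (a ∷ b ∷ l ++ [ z ]) → NonBacktracking (b ∷ l ++ [ z ])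
    tail [] _ = tt
    tail (_ ∷ _) (_ , nb) = nb
  ... | inj₁ e = inj₁ e
  ... | inj₂ lt = inj₂ (ℕ.<-trans lt (Child-< c))

  last∈ : ∀ a l → last a l List.∈ a ∷ l
  last∈ a [] = here refl
  last∈ a (b ∷ l) = there (last∈ b l)

  -- A cycle starting downwards from `x` would descend back to `x`. One starting upwards to the
  -- parent `y` either enters `x` at the end from its parent, repeating `y`, or gives `x` a smaller
  -- number than its parent.
  acyclic : ¬ HasCycle tree
  acyclic (x , y ∷ z ∷ l , (x≢@(x≢y ∷ x≢z ∷ _)) ∷ u@(y≢ ∷ _) , _ , (xy , k)) with edge⁻ {x} {y} xy
  ... | inj₂ c = ℕ.<-irrefl refl (proj₂ (descending x y (z ∷ l) x c k
          (x≢z , unique⇒nonBacktracking y (z ∷ l) x u x≢)))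
  ... | inj₁ c with last-step y (z ∷ l) x k (unique⇒nonBacktracking y (z ∷ l) x u x≢)
  ... | inj₁ c′ = All.lookup y≢ (last∈ z l) (same-parent c c′)
  ... | inj₂ lt = ℕ.<-asym lt (Child-< c)
  acyclic (x , [] , _ , () , _)
  acyclic (x , _ ∷ [] , _ , s≤s () , _)

  isTree-tree : IsTree tree
  isTree-tree = s≤s z≤n , (λ {u} {v} _ _ → reach-trans (to-root u) (reach-sym (to-root v))) , acyclic
    where
    to-root : ∀ x → Reach tree (λ _ → ⊤) x zero
    to-root x = climb (λ _ → ⊤) zero up tt
      where
      up : ∀ {x} → ⊤ → x ≢ zero → ∃[ y ] (Child x y × ⊤)
      up {zero} _ z≢z = ⊥-elim (z≢z refl)
      up {suc x} _ _ = let y , c , _ = parent x in y , c , tt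

-- The partition

_[_≔_] : ∀ {A : Set} → (ℕ → A) → ℕ → A → ℕ → A
(f [ k ≔ a ]) q with q ℕ.≟ k
... | yes _ = a
... | no _  = f q

≔-at : ∀ {A : Set} (f : ℕ → A) k {a} → (f [ k ≔ a ]) k ≡ a
≔-at f k with k ℕ.≟ k
... | yes _ = refl
... | no k≢k = ⊥-elim (k≢k refl)

≔-below : ∀ {A : Set} (f : ℕ → A) {m q a} → q ≤ m → (f [ suc m ≔ a ]) q ≡ f q
≔-below f {m} {q} q≤m with q ℕ.≟ suc m
... | yes refl = ⊥-elim (ℕ.1+n≰n q≤m)
... | no _ = refl

module Construction {G : Graph} (D : TreeDecomposition G) {s ℓ : ℕ} (1≤ℓ : 1 ≤ ℓ)
                    (free : JMinorFree s (suc ℓ) G) where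
  open Reachability G

  -- Parts are labelled 1, …, m, and also serve as the nodes of the tree, whose
  -- root is the extra node 0.  The label 0 marks unassigned vertices, and in a
  -- bag it is a dummy.
  Bag : (ℕ → Fin s → ℕ) → ℕ → ℕ → Set
  Bag labs q r = r ≡ q ⊎ ∃[ i ] r ≡ labs q i

  unassigned? : ∀ (label : V G → ℕ) v → Dec (label v ≡ 0)
  unassigned? label v = label v ℕ.≟ 0

  Un : (V G → ℕ) → Subset (n G)
  Un label = ⟦ unassigned? label ⟧

  -- R i is the set of v with ρ v ≡ just i.  A slot i that C does not touch is
  -- free: ρ-outside is all that is required of R i.
  record Context (m : ℕ) (label : V G → ℕ) (labs : ℕ → Fin s → ℕ) (C : Subset (n G)) : Set where
    field
      node        : ℕ
      node≤m      : node ≤ m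
      lab         : Fin s → ℕ
      lab∈        : ∀ i → Bag labs node (lab i)
      ρ           : V G → Maybe (Fin s)
    open Touching G ρ public
    field
      ρ-outside   : ∀ {v i} → ρ v ≡ just i → v ∉ C
      ρ-connected : ∀ i → Touch C i → ConnectedIn G (λ v → ρ v ≡ just i)
      ρ-adjacent  : ∀ {i j} → i ≢ j → Touch C i → Touch C j →
                    ∃[ u ] ∃[ v ] (ρ u ≡ just i × ρ v ≡ just j × Adj G u v)
      boundary    : ∀ {x v} → x ∈ C → Adj G x v → v ∉ C → ∃[ i ] (ρ v ≡ just i × label v ≡ lab i)

  -- By `labs∈`, the bags holding a label are closed under parents up to the label's own node, which
  -- makes them a subtree. By `edges`, of two adjacent parts one lies in the bag of the other's
  -- node.
  record State : Set where
    field
      m         : ℕ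
      label      : V G → ℕ
      par       : ℕ → ℕ
      labs      : ℕ → Fin s → ℕ
      root-labs : ∀ i → labs 0 i ≡ 0
      par≤      : ∀ {q} → q < m → par (suc q) ≤ q
      labs∈     : ∀ {q} → q < m → ∀ i → Bag labs (par (suc q)) (labs (suc q) i)
      bounded   : ∀ v → label v ≤ m
      inhabited : ∀ {q} → q < m → ∃[ v ] label v ≡ suc q
      width     : ∀ {q} → q < m → WWidthSetAtMost D ℓ (λ v → label v ≡ suc q)
      edges     : ∀ {u v} → Adj G u v → label u ≢ 0 → label v ≢ 0 → label u ≢ label v →
                  Bag labs (label v) (label u) ⊎ Bag labs (label u) (label v)
      context   : ∀ {v} → label v ≡ 0 → Context m label labs (comp (Un label) v)

  -- Adding one part

  module Extend (σ : State) {v₀} (unassigned : State.label σ v₀ ≡ 0) where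
    open State σ

    C : Subset (n G)
    C = comp (Un label) v₀

    v₀∈C : v₀ ∈ C
    v₀∈C = comp-self (∈⟦⟧⁺ (unassigned? label) unassigned)

    open Context (context unassigned)
    open Splitting D 1≤ℓ free C comp-connected v₀∈C ρ using (piece; module Slot; module Cut; cut)
    open Cut (cut ρ-outside ρ-connected ρ-adjacent)

    label′ : V G → ℕ
    label′ = override P (suc m) label

    -- The new node hangs below the node of the context of `C`, whose bag already holds all labels
    -- in `lab`.
    par′ : ℕ → ℕ
    par′ = par [ suc m ≔ node ]

    labs′ : ℕ → Fin s → ℕ
    labs′ = labs [ suc m ≔ lab ]

    label′-∈ : ∀ {v} → v ∈ P → label′ v ≡ suc m
    label′-∈ = override-∈ P (suc m) label

    label′-∉ : ∀ {v} → v ∉ P → label′ v ≡ label v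
    label′-∉ = override-∉ P (suc m) label

    C-un : ∀ {v} → v ∈ C → label v ≡ 0
    C-un h = ∈⟦⟧⁻ (unassigned? label) (comp⊆ h)

    un′⁻ : ∀ {v} → label′ v ≡ 0 → v ∉ P × label v ≡ 0
    un′⁻ e with override⁻ P (suc m) label e
    ... | inj₁ (_ , ())
    ... | inj₂ r = r

    Un′⊆Un : Un label′ ⊆ Un label
    Un′⊆Un h = ∈⟦⟧⁺ (unassigned? label) (proj₂ (un′⁻ (∈⟦⟧⁻ (unassigned? label′) h)))

    Un′⁺ : ∀ {v} → label v ≡ 0 → v ∉ P → v ∈ Un label′
    Un′⁺ e v∉P = ∈⟦⟧⁺ (unassigned? label′) (trans (label′-∉ v∉P) e)

    progress : Un label′ ⊂ Un label
    progress = let v , v∈P = nonempty in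
      Un′⊆Un , v , comp⊆ (P⊆C v∈P) , λ h → proj₁ (un′⁻ (∈⟦⟧⁻ (unassigned? label′) h)) v∈P

    Bag-old : ∀ {q r} → q ≤ m → Bag labs q r → Bag labs′ q r
    Bag-old q≤m (inj₁ e) = inj₁ e
    Bag-old q≤m (inj₂ (i , e)) = inj₂ (i , trans e (cong (λ f → f i) (sym (≔-below labs q≤m))))

    Bag-new : ∀ i → Bag labs′ (suc m) (lab i)
    Bag-new i = inj₂ (i , cong (λ f → f i) (sym (≔-at labs (suc m))))

    C-closed : ∀ {a b} → a ∈ C → Adj G a b → label b ≡ 0 → b ∈ C
    C-closed a∈C ab e = comp-step a∈C ab (∈⟦⟧⁺ (unassigned? label) e)

    -- `C` is a whole component of unassigned vertices, so a walk through vertices that remain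
    -- unassigned cannot leave `C ─ P`.
    piece-eq : ∀ {w} → w ∈ C ─ P → piece P w ≡ comp (Un label′) w
    piece-eq {w} w∈ = ⊆-antisym (comp-mono λ h → let x∈C , x∉P = ∈─⁻ C P h in Un′⁺ (C-un x∈C) x∉P)
      λ h → ∈comp⁺ (reach-into closed w∈ (∈comp⁻ h))
      where
      closed : ∀ {a b} → a ∈ C ─ P → Adj G a b → b ∈ Un label′ → b ∈ C ─ P
      closed a∈ ab b∈ = let b∉P , e = un′⁻ (∈⟦⟧⁻ (unassigned? label′) b∈) in
        x∈p∧x∉q⇒x∈p─q (C-closed (proj₁ (∈─⁻ C P a∈)) ab e) b∉P

    other-avoids : ∀ {w} → w ∉ C → ∀ {x} → x ∈ comp (Un label) w → x ∉ C
    other-avoids w∉C = comp-avoids w∉C λ a∈C ab _ b∈ → comp-step a∈C ab b∈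

    other-eq : ∀ {w} → w ∉ C → label w ≡ 0 → comp (Un label) w ≡ comp (Un label′) w
    other-eq {w} w∉C e = ⊆-antisym
      (λ h → ∈comp⁺ (reach-mono
        (λ h′ → Un′⁺ (∈⟦⟧⁻ (unassigned? label) (comp⊆ h′)) (λ x∈P → other-avoids w∉C h′ (P⊆C x∈P)))
        (comp-connected (comp-self (∈⟦⟧⁺ (unassigned? label) e)) h)))
      (comp-mono Un′⊆Un)

    context-other : ∀ {w} → w ∉ C → label w ≡ 0 → Context (suc m) label′ labs′ (comp (Un label) w)
    context-other {w} w∉C e = record
      { node = X.node ; node≤m = ℕ.m≤n⇒m≤1+n X.node≤m
      ; lab = X.lab ; lab∈ = λ i → Bag-old X.node≤m (X.lab∈ i)
      ; ρ = X.ρ ; ρ-outside = X.ρ-outside ; ρ-connected = X.ρ-connected ; ρ-adjacent = X.ρ-adjacent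
      ; boundary = λ x∈ xv v∉ → let i , eρ , ep = X.boundary x∈ xv v∉ in
          i , eρ , trans (label′-∉ λ v∈P → v∉ (comp-step x∈ xv (comp⊆ (P⊆C v∈P)))) ep }
      where module X = Context (context e)

    module _ {w} (w∈ : w ∈ C ─ P) where
      open Slot (slots w∈) renaming (adjacent to R-adjacent; connected to R-connected)

      K : Subset (n G)
      K = piece P w

      K⊆C : K ⊆ C
      K⊆C h = p─q⊆p C P (comp⊆ h)

      at? : ∀ v → Dec (ρ v ≡ just i)
      at? v = ≡-dec Fin._≟_ (ρ v) (just i)

      -- The old `i`-th set is cleared first, since `R` need not contain it.
      ρ⁻ : V G → Maybe (Fin s)
      ρ⁻ = override ⟦ at? ⟧ nothing ρ

      ρ′ : V G → Maybe (Fin s)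
      ρ′ = override R (just i) ρ⁻

      -- The new label takes over index `i`. Dropping the old label there is safe because `K` misses
      -- `i`, so no neighbour of `K` is recorded at it.
      lab′ : Fin s → ℕ
      lab′ = override ⁅ i ⁆ (suc m) lab

      module Touch′ = Touching G ρ′

      ρ′-at : ∀ {v} → v ∈ R → ρ′ v ≡ just i
      ρ′-at = override-∈ R (just i) ρ⁻

      ρ′-other : ∀ {v j} → j ≢ i → ρ v ≡ just j → ρ′ v ≡ just j
      ρ′-other {v} {j} j≢i e = trans
        (override-∉ R (just i) ρ⁻ λ v∈R →
          [ ρ-outside e , (λ e′ → j≢i (just-injective (trans (sym e) e′))) ]′ (origin v∈R))
        (trans (override-∉ ⟦ at? ⟧ nothing ρ λ h →
          j≢i (just-injective (trans (sym e) (∈⟦⟧⁻ at? h)))) e)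

      ρ′⁻ : ∀ {v j} → ρ′ v ≡ just j → (v ∈ R × j ≡ i) ⊎ (j ≢ i × ρ v ≡ just j)
      ρ′⁻ {v} {j} e with override⁻ R (just i) ρ⁻ e
      ... | inj₁ (v∈R , e′) = inj₁ (v∈R , just-injective (sym e′))
      ... | inj₂ (_ , e′) with override⁻ ⟦ at? ⟧ nothing ρ e′
      ... | inj₁ (_ , ())
      ... | inj₂ (v∉ , e″) = inj₂ ((λ where refl → v∉ (∈⟦⟧⁺ at? e″)) , e″)

      ρ′-at⁻ : ∀ {v} → ρ′ v ≡ just i → v ∈ R
      ρ′-at⁻ e = [ proj₁ , (λ (i≢i , _) → ⊥-elim (i≢i refl)) ]′ (ρ′⁻ e)

      ρ′-other⁻ : ∀ {v j} → j ≢ i → ρ′ v ≡ just j → ρ v ≡ just j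
      ρ′-other⁻ j≢i e = [ (λ (_ , j≡i) → ⊥-elim (j≢i j≡i)) , proj₂ ]′ (ρ′⁻ e)

      touch-old : ∀ {j} → j ≢ i → Touch′.Touch K j → Touch K j
      touch-old j≢i (x , u , x∈ , e , a) = x , u , x∈ , ρ′-other⁻ j≢i e , a

      touch-C : ∀ {j} → j ≢ i → Touch′.Touch K j → Touch C j
      touch-C j≢i t = touch-mono K⊆C (touch-old j≢i t)

      context-piece : Context (suc m) label′ labs′ K
      context-piece = record
        { node = suc m ; node≤m = ℕ.≤-refl ; lab = lab′ ; lab∈ = lab′∈
        ; ρ = ρ′ ; ρ-outside = outside′ ; ρ-connected = connected′ ; ρ-adjacent = adjacent′
        ; boundary = boundary′ }
        where
        lab′∈ : ∀ j → Bag labs′ (suc m) (lab′ j)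
        lab′∈ j with override⁻ ⁅ i ⁆ (suc m) lab {j} refl
        ... | inj₁ (_ , e) = inj₁ (sym e)
        ... | inj₂ (_ , e) = subst (Bag labs′ (suc m)) e (Bag-new j)
        outside′ : ∀ {v j} → ρ′ v ≡ just j → v ∉ K
        outside′ e v∈K = [ (λ (v∈R , _) → avoids v∈K v∈R) , (λ (_ , e′) → ρ-outside e′ (K⊆C v∈K)) ]′ (ρ′⁻ e)
        connected′ : ∀ j → Touch′.Touch K j → ConnectedIn G (λ v → ρ′ v ≡ just j)
        connected′ j t eu ev with j Fin.≟ i
        ... | yes refl = reach-mono ρ′-at (R-connected (ρ′-at⁻ eu) (ρ′-at⁻ ev))
        ... | no j≢i = reach-mono (ρ′-other j≢i)
                (ρ-connected j (touch-C j≢i t) (ρ′-other⁻ j≢i eu) (ρ′-other⁻ j≢i ev))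
        adjacent′ : ∀ {j k} → j ≢ k → Touch′.Touch K j → Touch′.Touch K k →
          ∃[ u ] ∃[ v ] (ρ′ u ≡ just j × ρ′ v ≡ just k × Adj G u v)
        adjacent′ {j} {k} j≢k tj tk with j Fin.≟ i | k Fin.≟ i
        ... | yes refl | yes refl = ⊥-elim (j≢k refl)
        ... | yes refl | no k≢i = let x , u , x∈R , e , a = R-adjacent k≢i (touch-old k≢i tk) in
          x , u , ρ′-at x∈R , ρ′-other k≢i e , a
        ... | no j≢i | yes refl = let x , u , x∈R , e , a = R-adjacent j≢i (touch-old j≢i tj) in
          u , x , ρ′-other j≢i e , ρ′-at x∈R , Adj-sym a
        ... | no j≢i | no k≢i = let u , v , eu , ev , a = ρ-adjacent j≢k (touch-C j≢i tj) (touch-C k≢i tk) in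
          u , v , ρ′-other j≢i eu , ρ′-other k≢i ev , a
        boundary′ : ∀ {x v} → x ∈ K → Adj G x v → v ∉ K → ∃[ j ] (ρ′ v ≡ just j × label′ v ≡ lab′ j)
        boundary′ {x} {v} x∈K xv v∉K = case v ∈? P of λ where
            (yes v∈P) → i , ρ′-at (P⊆R v∈P) ,
              trans (label′-∈ v∈P) (sym (override-∈ ⁅ i ⁆ (suc m) lab (x∈⁅x⁆ i)))
            (no v∉P) → old v∉P (boundary (K⊆C x∈K) xv λ v∈C → v∉K (comp-step x∈K xv (x∈p∧x∉q⇒x∈p─q v∈C v∉P)))
          where
          old : v ∉ P → ∃[ j ] (ρ v ≡ just j × label v ≡ lab j) → ∃[ j ] (ρ′ v ≡ just j × label′ v ≡ lab′ j)
          old v∉P (j , eρ , ep) = j , ρ′-other j≢i eρ ,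
            trans (label′-∉ v∉P) (trans ep (sym (override-∉ ⁅ i ⁆ (suc m) lab (x≢y⇒x∉⁅y⁆ j≢i))))
            where
            j≢i : j ≢ i
            j≢i j≡i = missed (x , v , x∈K , trans eρ (cong just j≡i) , xv)

    context′ : ∀ {w} → label′ w ≡ 0 → Context (suc m) label′ labs′ (comp (Un label′) w)
    context′ {w} e with un′⁻ e | w ∈? C
    ... | w∉P , _  | yes w∈C = subst (Context (suc m) label′ labs′) (piece-eq w∈) (context-piece w∈)
      where
      w∈ : w ∈ C ─ P
      w∈ = x∈p∧x∉q⇒x∈p─q w∈C w∉P
    ... | _ , e₀ | no w∉C = subst (Context (suc m) label′ labs′) (other-eq w∉C e₀) (context-other w∉C e₀)

    -- An assigned neighbour of `P ⊆ C` is on the boundary of `C`, so its label is among the labels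
    -- `lab` stored at the new node.
    new-edge : ∀ {u v} → Adj G u v → u ∈ P → v ∉ P → label v ≢ 0 → Bag labs′ (label′ u) (label′ v)
    new-edge {u} {v} uv u∈P v∉P nz with boundary (P⊆C u∈P) uv (λ v∈C → nz (C-un v∈C))
    ... | i , _ , e rewrite label′-∈ u∈P | label′-∉ v∉P | e = Bag-new i

    edges′ : ∀ {u v} → Adj G u v → label′ u ≢ 0 → label′ v ≢ 0 → label′ u ≢ label′ v →
      Bag labs′ (label′ v) (label′ u) ⊎ Bag labs′ (label′ u) (label′ v)
    edges′ {u} {v} uv nu nv u≢v = go (u ∈? P) (v ∈? P)
      where
      go : Dec (u ∈ P) → Dec (v ∈ P) → Bag labs′ (label′ v) (label′ u) ⊎ Bag labs′ (label′ u) (label′ v)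
      go (yes u∈P) (yes v∈P) = ⊥-elim (u≢v (trans (label′-∈ u∈P) (sym (label′-∈ v∈P))))
      go (yes u∈P) (no v∉P) = inj₂ (new-edge uv u∈P v∉P λ e → nv (trans (label′-∉ v∉P) e))
      go (no u∉P) (yes v∈P) = inj₁ (new-edge (Adj-sym uv) v∈P u∉P λ e → nu (trans (label′-∉ u∉P) e))
      go (no u∉P) (no v∉P) rewrite label′-∉ u∉P | label′-∉ v∉P =
        [ (λ b → inj₁ (Bag-old (bounded v) b)) , (λ b → inj₂ (Bag-old (bounded u) b)) ]′ (edges uv nu nv u≢v)

    cases : ∀ {q} → q < suc m → q < m ⊎ q ≡ m
    cases (s≤s q≤m) = ℕ.m≤n⇒m<n∨m≡n q≤m

    state : State
    state = record
      { m = suc m ; label = label′ ; par = par′ ; labs = labs′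
      ; root-labs = λ i → trans (cong (λ f → f i) (≔-below labs {m} {0} {lab} z≤n)) (root-labs i)
      ; par≤ = par′≤
      ; labs∈ = labs′∈
      ; bounded = bounded′
      ; inhabited = inhabited′
      ; width = width′
      ; edges = edges′
      ; context = context′
      }
      where
      par′≤ : ∀ {q} → q < suc m → par′ (suc q) ≤ q
      par′≤ lt with cases lt
      ... | inj₁ q<m = subst (_≤ _) (sym (≔-below par q<m)) (par≤ q<m)
      ... | inj₂ refl = subst (_≤ m) (sym (≔-at par (suc m))) node≤m
      labs′∈ : ∀ {q} → q < suc m → ∀ i → Bag labs′ (par′ (suc q)) (labs′ (suc q) i)
      labs′∈ lt i with cases lt
      ... | inj₁ q<m rewrite ≔-below par {a = node} q<m | ≔-below labs {a = lab} q<m =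
        Bag-old (ℕ.≤-trans (par≤ q<m) (ℕ.<⇒≤ q<m)) (labs∈ q<m i)
      ... | inj₂ refl rewrite ≔-at par (suc m) {node} | ≔-at labs (suc m) {lab} = Bag-old node≤m (lab∈ i)
      bounded′ : ∀ v → label′ v ≤ suc m
      bounded′ v with override⁻ P (suc m) label {v} refl
      ... | inj₁ (_ , e) = ℕ.≤-reflexive (sym e)
      ... | inj₂ (_ , e) = subst (_≤ suc m) e (ℕ.m≤n⇒m≤1+n (bounded v))
      inhabited′ : ∀ {q} → q < suc m → ∃[ v ] label′ v ≡ suc q
      inhabited′ lt with cases lt
      ... | inj₂ refl = let v , v∈P = nonempty in v , label′-∈ v∈P
      ... | inj₁ q<m = let v , e = inhabited q<m in
        -- Old parts lose no vertex, as the vertices of `P` had label 0.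
        v , trans (label′-∉ λ v∈P → ℕ.1+n≢0 (trans (sym e) (C-un (P⊆C v∈P)))) e
      width′ : ∀ {q} → q < suc m → WWidthSetAtMost D ℓ (λ v → label′ v ≡ suc q)
      width′ {q} lt with cases lt
      ... | inj₂ refl = ⋃ (map ⁅_⁆ nodes) , ℕ.≤-trans (∣⋃⁅⁆∣≤length nodes) size , covered
        where
        covered : ∀ v → label′ v ≡ suc m → ∃[ x ] (x ∈ ⋃ (map ⁅_⁆ nodes) × v ∈ W D x)
        covered v e with override⁻ P (suc m) label {v} e
        ... | inj₂ (_ , e′) = ⊥-elim (ℕ.1+n≰n (subst (_≤ m) e′ (bounded v)))
        ... | inj₁ (v∈P , _) = let x , x∈ , v∈ = ∈⋃-map⁻ nodes (P⊆W v∈P) in x , ∈⋃⁅⁆ x∈ , v∈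
      ... | inj₁ q<m = let Z , size , cov = width q<m in Z , size , λ v e →
        [ (λ (_ , e′) → ⊥-elim (ℕ.<-irrefl (sym (ℕ.suc-injective e′)) q<m)) , (λ (_ , e′) → cov v e′) ]′
        (override⁻ P (suc m) label {v} e)

  initial : State
  initial = record
    { m = 0 ; label = λ _ → 0 ; par = λ _ → 0 ; labs = λ _ _ → 0
    ; root-labs = λ _ → refl ; par≤ = λ () ; labs∈ = λ () ; bounded = λ _ → z≤n
    ; inhabited = λ () ; width = λ ()
    ; edges = λ _ nz _ _ → ⊥-elim (nz refl)
    ; context = λ {v} _ → record
        { node = 0 ; node≤m = z≤n ; lab = λ _ → 0 ; lab∈ = λ _ → inj₁ refl ; ρ = λ _ → nothing
        ; ρ-outside = λ () ; ρ-connected = λ i _ () ; ρ-adjacent = λ where _ (_ , _ , _ , () , _)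
        ; boundary = λ x∈ xv v∉ → ⊥-elim (v∉ (comp-step x∈ xv (∈⟦⟧⁺ (unassigned? (λ _ → 0)) refl))) } }

  final : ∃[ σ ] (∀ v → State.label σ v ≢ 0)
  final = go initial (⊂-wellFounded _)
    where
    go : ∀ σ → Acc _⊂_ (Un (State.label σ)) → ∃[ σ ] (∀ v → State.label σ v ≢ 0)
    go σ (acc rec) with Fin.any? (unassigned? (State.label σ))
    ... | no none = σ , λ v e → none (v , e)
    ... | yes (v , e) = go (Extend.state σ e) (rec (Extend.progress σ e))

  -- The partition and its tree-decomposition

  module Result (σ : State) (assigned : ∀ v → State.label σ v ≢ 0) where
    open State σ

    index : ∀ {k} → k ≢ 0 → k ≤ m → ∃[ x ] suc (toℕ {m} x) ≡ k
    index {zero} nz _ = ⊥-elim (nz refl)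
    index {suc k} _ k<m = fromℕ< k<m , cong suc (Fin.toℕ-fromℕ< k<m)

    cell : V G → Fin m
    cell v = proj₁ (index (assigned v) (bounded v))

    cell-part : ∀ v → suc (toℕ (cell v)) ≡ label v
    cell-part v = proj₂ (index (assigned v) (bounded v))

    open Quotient G (λ v → just (cell v))

    partition : Partition G
    partition = record
      { H = quotient ; part = cell
      ; part-nonempty = λ X → let v , e = inhabited (Fin.toℕ<n X) in
          v , Fin.toℕ-injective (ℕ.suc-injective (trans (cell-part v) e))
      ; part-edge = λ v w vw → case cell v Fin.≟ cell w of λ where
          (yes e) → inj₁ e
          (no ne) → inj₂ (Adj⁺ (ne , v , w , refl , refl , vw)) }

    partition-width : WWidthAtMost D ℓ partition
    partition-width X = let Z , size , cov = width (Fin.toℕ<n X) in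
      Z , size , λ v e → cov v (trans (sym (cell-part v)) (cong (λ X → suc (toℕ X)) e))

    open ParentTree m par par≤
    private module P = Reachability tree

    bag? : ∀ q r → Dec (Bag labs q r)
    bag? q r = (r ℕ.≟ q) ⊎-dec Fin.any? λ i → r ℕ.≟ labs q i

    in-bag? : ∀ q (X : Fin m) → Dec (Bag labs q (suc (toℕ X)))
    in-bag? q X = bag? q (suc (toℕ X))

    bag : Fin (suc m) → Subset m
    bag x = ⟦ in-bag? (toℕ x) ⟧

    -- The root's bag holds only the dummy label. At any other node, a label that is not the node's
    -- own passes to the parent by `labs∈`.
    up : ∀ X {x} → X ∈ bag x → x ≢ suc X → ∃[ y ] (Child x y × X ∈ bag y)
    up X {zero} X∈ _ with ∈⟦⟧⁻ (in-bag? 0) X∈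
    ... | inj₂ (i , e) = ⊥-elim (ℕ.1+n≢0 (trans e (root-labs i)))
    up X {suc q} X∈ ne with ∈⟦⟧⁻ (in-bag? (suc (toℕ q))) X∈ | parent q
    ... | inj₁ e | _ = ⊥-elim (ne (cong suc (Fin.toℕ-injective (ℕ.suc-injective (sym e)))))
    ... | inj₂ (i , e) | y , c , ey = y , c , ∈⟦⟧⁺ (in-bag? (toℕ y))
      (subst (λ q → Bag labs q (suc (toℕ X))) (sym ey)
        (subst (Bag labs (par (suc (toℕ q)))) (sym e) (labs∈ (Fin.toℕ<n q) i)))

    own : ∀ X → X ∈ bag (suc X)
    own X = ∈⟦⟧⁺ (in-bag? (suc (toℕ X))) (inj₁ refl)

    covered : ∀ u v → Bag labs (label u) (label v) → cell v ∈ bag (suc (cell u))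
    covered u v b = ∈⟦⟧⁺ (in-bag? (suc (toℕ (cell u))))
      (subst (λ r → Bag labs (suc (toℕ (cell u))) r) (sym (cell-part v))
        (subst (λ q → Bag labs q (label v)) (sym (cell-part u)) b))

    decomposition : TreeDecomposition quotient
    decomposition = record
      { Tr = tree ; isTree = isTree-tree ; W = bag
      ; vertex-nonempty = λ X → suc X , own X
      ; vertex-subtree = λ X p q → P.reach-trans (climb (λ x → X ∈ bag x) (suc X) (up X) p)
          (P.reach-sym (climb (λ x → X ∈ bag x) (suc X) (up X) q))
      ; edge-covered = λ X Y a → edge (Adj⁻ a) }
      where
      edge : ∀ {X Y} → Joined X Y → ∃[ x ] (X ∈ bag x × Y ∈ bag x)
      edge (ne , u , v , refl , refl , uv)
        with edges uv (assigned u) (assigned v) (λ e → ne (Fin.toℕ-injective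
               (ℕ.suc-injective (trans (cell-part u) (trans e (sym (cell-part v)))))))
      ... | inj₁ b = suc (cell v) , covered v u b , own (cell v)
      ... | inj₂ b = suc (cell u) , own (cell u) , covered u v b

    single? : ∀ r (X : Fin m) → Dec (suc (toℕ X) ≡ r)
    single? r X = suc (toℕ X) ℕ.≟ r

    ∣single∣≤1 : ∀ r → ∣ ⟦ single? r ⟧ ∣ ≤ 1
    ∣single∣≤1 r = subsingleton⇒∣p∣≤1 λ p q → Fin.toℕ-injective (ℕ.suc-injective
      (trans (∈⟦⟧⁻ (single? r) p) (sym (∈⟦⟧⁻ (single? r) q))))

    -- The node's own label and the `s` entries of `labs` stand for at most one part each.
    bag-size : ∀ x → ∣ bag x ∣ ≤ suc s
    bag-size x = ℕ.≤-trans (p⊆q⇒∣p∣≤∣q∣ {p = bag x} within)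
      (subst (∣ ⋃ (map single labels) ∣ ≤_) (cong suc (length-tabulate (labs (toℕ x))))
        (∣⋃∣≤length single ∣single∣≤1 labels))
      where
      single : ℕ → Subset m
      single r = ⟦ single? r ⟧
      labels = toℕ x ∷ tabulate (labs (toℕ x))
      within : bag x ⊆ ⋃ (map single labels)
      within {X} X∈ = ⋃-∈ (List.∈-map⁺ single label∈) (∈⟦⟧⁺ (single? (suc (toℕ X))) refl)
        where
        label∈ : suc (toℕ X) List.∈ labels
        label∈ with ∈⟦⟧⁻ (in-bag? (toℕ x)) X∈
        ... | inj₁ e = here e
        ... | inj₂ (i , e) = there (subst (List._∈ tabulate (labs (toℕ x))) (sym e) (List.∈-tabulate⁺ i))

theorem12 : (s t : ℕ) → 2 ≤ s → 2 ≤ t → (G : Graph) → JMinorFree s t G →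
    (D : TreeDecomposition G) →
    Σ (Partition G) λ P → WWidthAtMost D (t ∸ 1) P × TreewidthAtMost s (H P)
theorem12 s (suc ℓ) _ (s≤s 1≤ℓ) G free D = partition , partition-width , decomposition , bag-size
  where
  open Construction D 1≤ℓ free
  open Result (proj₁ final) (proj₂ final)
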